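{- Let $0<\varepsilon<1/200$. There is $n_0(\varepsilon)$ such that for all $n\ge n_0(\varepsilon)$ the following holds. Let $\mathcal{H}$ be the $3$-uniform hypergraph with vertex set $\mathcal{P}(n)$ whose edges are the triples $\{A,B,C\}$ of distinct sets with $A\cup B=C$, with rooting function $f(\{A,B,C\})=C$ (the head of an edge is the union of the other two sets). If $\mathcal{F}\subseteq\mathcal{P}(n)$ satisfies $|\mathcal{F}|\ge (1+\varepsilon)\binom{n}{\lfloor n/2\rfloor}$, then $\mathcal{F}$ contains an $\left(\mathcal{F},n,\frac{\varepsilon^2}{10^{40}}n^2\right)$-eligible vertex.
   Context: For $\mathcal{F}\subseteq\mathcal{P}(n)$ and $C\in\mathcal{F}$, the head link graph $\mathrm{HL}_C(\mathcal{H}\cap\mathcal{F})$ is the graph on vertex set $\mathcal{F}$ whose edges are the pairs $\{A,B\}$ of sets in $\mathcal{F}$ such that $A,B,C$ are distinct and $A\cup B=C$. A set $C\in\mathcal{F}$ is $(\mathcal{F},s,t)$-eligible if $\mathrm{HL}_C(\mathcal{H}\cap\mathcal{F})$ has a subgraph with maximum degree at most $s$ and at least $t$ edges.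
   Formalization: The parameter ε, a real number with 0 < ε < 1/200 in the statement, is taken to be rational. -}

module Defs where

open import Data.Nat using (ℕ; _≤_)
open import Data.Bool using (Bool)
import Data.Bool as Bool
open import Data.Fin.Subset using (Subset; _∪_)
open import Data.Vec.Properties using (≡-dec)
open import Data.Product using (_×_; _,_; Σ; ∃)
open import Data.Sum using (_⊎_)
open import Data.List using (List; length; filter)
open import Data.List.Membership.Propositional using (_∈_)
open import Data.List.Relation.Unary.All using (All)
open import Data.List.Relation.Unary.AllPairs using (AllPairs)
open import Data.List.Relation.Unary.Unique.Propositional using (Unique)
open import Relation.Binary.PropositionalEquality using (_≡_; _≢_)
open import Relation.Nullary using (¬_; Dec)
open import Relation.Nullary.Decidable using (_⊎-dec_)
open import Data.Rational using (ℚ; _/_)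
import Data.Rational as ℚ
open import Data.Integer using (+_)

-- P(n) is represented by Subset n (= Vec Bool n) from Data.Fin.Subset.
-- A family 𝓕 ⊆ P(n) is a duplicate-free list of subsets; |𝓕| = its length.

_≟ₛ_ : ∀ {n} (A B : Subset n) → Dec (A ≡ B)
_≟ₛ_ = ≡-dec Bool._≟_

-- an (undirected) edge {A,B} is represented by an ordered pair (A , B)
Edge : ℕ → Set
Edge n = Subset n × Subset n

SameEdge : ∀ {n} → Edge n → Edge n → Set
SameEdge (A , B) (A' , B') = (A ≡ A' × B ≡ B') ⊎ (A ≡ B' × B ≡ A')

IsHLEdge : ∀ {n} → List (Subset n) → Subset n → Edge n → Set
IsHLEdge 𝓕 C (A , B) =
  A ∈ 𝓕 × B ∈ 𝓕 × A ≢ B × A ≢ C × B ≢ C × A ∪ B ≡ C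

incident? : ∀ {n} (X : Subset n) (e : Edge n) → Dec ((Data.Product.proj₁ e ≡ X) ⊎ (Data.Product.proj₂ e ≡ X))
incident? X (A , B) = (A ≟ₛ X) ⊎-dec (B ≟ₛ X)

degree : ∀ {n} → List (Edge n) → Subset n → ℕ
degree E X = length (filter (incident? X) E)

IsHLSubgraph : ∀ {n} → List (Subset n) → Subset n → List (Edge n) → Set
IsHLSubgraph 𝓕 C E = All (IsHLEdge 𝓕 C) E × AllPairs (λ e e' → ¬ SameEdge e e') E

Eligible : ∀ {n} → List (Subset n) → ℕ → ℚ → Subset n → Set
Eligible {n} 𝓕 s t C =
  C ∈ 𝓕 × Σ (List (Edge n)) (λ E →
    IsHLSubgraph 𝓕 C E
    × (∀ (X : Subset n) → degree E X ≤ s)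
    × t ℚ.≤ (+ length E / 1))

{-# OPTIONS --safe #-}
-- Walk down a uniformly random maximal chain from the full set.  Restricted to the layers within
-- O(εn) of the middle, 𝓕 still has (1 + ε/2)·C(n, n/2) members, so by the LYM argument some C ∈ 𝓕
-- is such that the random chain below C meets 𝓕 again with probability at least ε/4, and it does so
-- within its first K = O(εn) steps.  Order C at random and cut 8/ε disjoint blocks of length K out
-- of it: by rotation invariance each block, used as the beginning of a chain, meets 𝓕 with the same
-- probability, so on average at least two blocks do.  Two such blocks yield A, B ∈ 𝓕 with A ∪ B = C.
-- Take a maximal subgraph E of HL_C with degrees at most n.  Each such pair lies in E or has one of
-- the at most 2|E|/n saturated sets as an endpoint; a given pair occurs with probability O(1/n²) and a
-- given set with probability O(1/n), so |E| = Ω(ε²n²).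
module Submission where

open import Defs
open import Data.Nat using (ℕ; zero; suc; _+_; _*_; _∸_; _^_; _/_; _%_; _!; _≤_; _<_; _≤?_; _<?_; z≤n; s≤s; NonZero)
import Data.Nat as ℕ
open import Data.Nat.Properties
open import Data.Nat.DivMod using (m≡m%n+[m/n]*n; m%n<n; m/n*n≤m; m/n*n≡m; m*n/n≡m; /-monoˡ-≤)
open import Data.Nat.Combinatorics using (nCk≡n!/k![n-k]!; k![n∸k]!∣n!; k>n⇒nCk≡0; nCk≡nC[n∸k]) renaming (_C_ to infixl 8 _choose_)
open import Data.Nat.Tactic.RingSolver using (solve-∀)
open import Data.Bool using (true; false; if_then_else_)
open import Data.Fin using (Fin; zero; suc)
import Data.Fin as Fin
open import Data.Fin.Subset using (Subset; inside; outside; ⊤; ∁; ∣_∣; _∈_; _∉_; _⊆_; _∩_; _∪_; _-_)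
open import Data.Fin.Subset.Properties using (_∈?_; _⊆?_; ⊆-refl; ⊆-reflexive; ⊆-trans; ⊆-antisym; ⊆⊤; ∣⊤∣≡n; ∣p∣≤n; p⊆q⇒∣p∣≤∣q∣; p⊂q⇒∣p∣<∣q∣; ∣∁p∣≡n∸∣p∣; ∁p⊆∁q⇒p⊇q; x∈p∩q⁺; x∈p∩q⁻; p∩q⊆p; x∈p∪q⁺; x∈p∪q⁻; p⊆p∪q; q⊆p∪q; ∪-comm; ∪-idem; p─⊥≡p; p─q⊆p; p─x─y≡p─y─x; x∈p∧x≢y⇒x∈p-y)
open import Data.Vec using ([]; _∷_; here; there)
open import Data.List using (List; []; _∷_; _++_; _∷ʳ_; map; take; drop; length; filter; allFin; tabulate; downFrom; cartesianProduct)
import Data.List.Properties as List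
import Data.List.Membership.Propositional as L
open import Data.List.Membership.Propositional.Properties using (∈-filter⁺; ∈-filter⁻; ∈-downFrom⁻; ∈-cartesianProduct⁺; ∈-cartesianProduct⁻)
open import Data.List.Relation.Unary.Any as Any using (Any; any?; here; there)
open import Data.List.Relation.Unary.All as All using (All; []; _∷_)
import Data.List.Relation.Unary.All.Properties as All
open import Data.List.Relation.Unary.AllPairs using (AllPairs; []; _∷_)
open import Data.List.Relation.Unary.Unique.Propositional using (Unique)
import Data.List.Relation.Unary.Unique.Propositional.Properties as Unique
open import Data.Product using (Σ; ∃; _×_; _,_; proj₁; proj₂)
open import Data.Sum using (_⊎_; inj₁; inj₂)
open import Data.Unit using (tt)
open import Function using (_∘_; id; case_of_)
open import Level using (0ℓ)
open import Relation.Binary.PropositionalEquality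
open import Relation.Nullary using (¬_; Dec; yes; no; does; contradiction; ¬?)
open import Relation.Nullary.Decidable using (dec-true; dec-false; _×-dec_; _⊎-dec_)
open import Relation.Unary using (Pred; Decidable)

-- Probabilities appear as numbers of orderings, out of `∣ C ∣ !`, and all estimates are cleared of
-- denominators. Sets A and B met in two disjoint blocks are obtained from C by removing disjoint
-- parts, and this is exactly what A ∪ B = C means for subsets of C. The price is that a hit must
-- occur early: 8/ε blocks have to fit into one ordering of C, so a block may only have length
-- O(εn). Hence the restriction to the middle layers, where no member of the family lies further
-- below C than that. Two expected hits are needed, not one, because k hit blocks guarantee only k -
-- 1 pairs; the surplus over 1 is what forces pairs to occur. The degree cap n balances the two ways
-- in which a pair can be covered. A saturated set is about n times as likely to be met as a given
-- edge, but there are at most 2|E|/n such sets, so they contribute no more than a constant multiple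
-- of what the edges contribute.

private variable
  n : ℕ
  X Y P P′ : Set

-- Indicators and finite sums

⟦_⟧ : Dec P → ℕ
⟦ d ⟧ = if does d then 1 else 0

⟦⟧-yes : (d : Dec P) → P → ⟦ d ⟧ ≡ 1
⟦⟧-yes d p rewrite dec-true d p = refl

⟦⟧-no : (d : Dec P) → ¬ P → ⟦ d ⟧ ≡ 0
⟦⟧-no d ¬p rewrite dec-false d ¬p = refl

⟦⟧≤1 : (d : Dec P) → ⟦ d ⟧ ≤ 1
⟦⟧≤1 (yes _) = ≤-refl
⟦⟧≤1 (no _)  = z≤n

1≤⟦⟧ : (d : Dec P) → P → 1 ≤ ⟦ d ⟧
1≤⟦⟧ d p = ≤-reflexive (sym (⟦⟧-yes d p))

⟦⟧≤ : (d : Dec P) {m : ℕ} → (P → 1 ≤ m) → ⟦ d ⟧ ≤ m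
⟦⟧≤ (yes p) h = h p
⟦⟧≤ (no _)  h = z≤n

⟦⟧-mono : (d : Dec P) (e : Dec P′) → (P → P′) → ⟦ d ⟧ ≤ ⟦ e ⟧
⟦⟧-mono d e f = ⟦⟧≤ d (1≤⟦⟧ e ∘ f)

⟦⟧-cong : (d : Dec P) (e : Dec P′) → (P → P′) → (P′ → P) → ⟦ d ⟧ ≡ ⟦ e ⟧
⟦⟧-cong d e f g = ≤-antisym (⟦⟧-mono d e f) (⟦⟧-mono e d g)

⟦⟧-× : (d : Dec P) (e : Dec P′) → ⟦ d ×-dec e ⟧ ≡ ⟦ d ⟧ * ⟦ e ⟧
⟦⟧-× (yes _) (yes _) = refl
⟦⟧-× (yes _) (no _)  = refl
⟦⟧-× (no _)  e       = refl

∑ : List X → (X → ℕ) → ℕ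
∑ []       f = 0
∑ (x ∷ xs) f = f x + ∑ xs f

∑-mono : (xs : List X) {f g : X → ℕ} → (∀ {x} → x L.∈ xs → f x ≤ g x) → ∑ xs f ≤ ∑ xs g
∑-mono []       h = z≤n
∑-mono (x ∷ xs) h = +-mono-≤ (h (Any.here refl)) (∑-mono xs (h ∘ Any.there))

∑-cong : (xs : List X) {f g : X → ℕ} → (∀ x → f x ≡ g x) → ∑ xs f ≡ ∑ xs g
∑-cong []       h = refl
∑-cong (x ∷ xs) h = cong₂ _+_ (h x) (∑-cong xs h)

∑-+ : (xs : List X) (f g : X → ℕ) → ∑ xs (λ x → f x + g x) ≡ ∑ xs f + ∑ xs g
∑-+ []       f g = refl
∑-+ (x ∷ xs) f g = begin
  f x + g x + ∑ xs (λ x → f x + g x) ≡⟨ cong (f x + g x +_) (∑-+ xs f g) ⟩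
  f x + g x + (∑ xs f + ∑ xs g)      ≡⟨ interchange (f x) (g x) (∑ xs f) (∑ xs g) ⟩
  f x + ∑ xs f + (g x + ∑ xs g)      ∎
  where
  open ≡-Reasoning
  interchange : ∀ a b c d → a + b + (c + d) ≡ a + c + (b + d)
  interchange = solve-∀

∑-*ˡ : (xs : List X) (c : ℕ) (f : X → ℕ) → ∑ xs (λ x → c * f x) ≡ c * ∑ xs f
∑-*ˡ []       c f = sym (*-zeroʳ c)
∑-*ˡ (x ∷ xs) c f = trans (cong (c * f x +_) (∑-*ˡ xs c f)) (sym (*-distribˡ-+ c (f x) (∑ xs f)))

∑-*ʳ : (xs : List X) (c : ℕ) (f : X → ℕ) → ∑ xs (λ x → f x * c) ≡ ∑ xs f * c
∑-*ʳ xs c f = trans (∑-cong xs (λ x → *-comm (f x) c)) (trans (∑-*ˡ xs c f) (*-comm c (∑ xs f)))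

∑-const : (xs : List X) (c : ℕ) → ∑ xs (λ _ → c) ≡ length xs * c
∑-const []       c = refl
∑-const (x ∷ xs) c = cong (c +_) (∑-const xs c)

∑-zero : (xs : List X) → ∑ xs (λ _ → 0) ≡ 0
∑-zero xs = trans (∑-const xs 0) (*-zeroʳ (length xs))

∑-swap : (xs : List X) (ys : List Y) (f : X → Y → ℕ) →
         ∑ xs (λ x → ∑ ys (f x)) ≡ ∑ ys (λ y → ∑ xs (λ x → f x y))
∑-swap []       ys f = sym (∑-zero ys)
∑-swap (x ∷ xs) ys f =
  trans (cong (∑ ys (f x) +_) (∑-swap xs ys f)) (sym (∑-+ ys (f x) (λ y → ∑ xs (λ x → f x y))))

∑-map : (h : X → Y) (xs : List X) (f : Y → ℕ) → ∑ (map h xs) f ≡ ∑ xs (f ∘ h)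
∑-map h []       f = refl
∑-map h (x ∷ xs) f = cong (f (h x) +_) (∑-map h xs f)

∑-member : {xs : List X} {x : X} (f : X → ℕ) → x L.∈ xs → f x ≤ ∑ xs f
∑-member f (Any.here refl)          = m≤m+n _ _
∑-member f (Any.there {x = y} x∈xs) = ≤-trans (∑-member f x∈xs) (m≤n+m _ (f y))

∑⟦∈⟧≡∣∣ : (C : Subset n) → ∑ (allFin n) (λ x → ⟦ x ∈? C ⟧) ≡ ∣ C ∣
∑⟦∈⟧≡∣∣ [] = refl
∑⟦∈⟧≡∣∣ {suc n} (b ∷ C) = begin
  ⟦ zero ∈? (b ∷ C) ⟧ + ∑ (tabulate suc) (λ x → ⟦ x ∈? (b ∷ C) ⟧)
    ≡⟨ cong (λ xs → ⟦ zero ∈? (b ∷ C) ⟧ + ∑ xs (λ x → ⟦ x ∈? (b ∷ C) ⟧)) (sym (List.map-tabulate id suc)) ⟩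
  ⟦ zero ∈? (b ∷ C) ⟧ + ∑ (map suc (allFin n)) (λ x → ⟦ x ∈? (b ∷ C) ⟧)
    ≡⟨ cong (⟦ zero ∈? (b ∷ C) ⟧ +_) (∑-map suc (allFin n) _) ⟩
  ⟦ zero ∈? (b ∷ C) ⟧ + ∑ (allFin n) (λ x → ⟦ x ∈? C ⟧)
    ≡⟨ cong (⟦ zero ∈? (b ∷ C) ⟧ +_) (∑⟦∈⟧≡∣∣ C) ⟩
  ⟦ zero ∈? (b ∷ C) ⟧ + ∣ C ∣
    ≡⟨ head b ⟩
  ∣ b ∷ C ∣ ∎
  where
  open ≡-Reasoning
  head : ∀ b → ⟦ zero ∈? (b ∷ C) ⟧ + ∣ C ∣ ≡ ∣ b ∷ C ∣
  head true  = refl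
  head false = refl

x∉p-x : (p : Subset n) (x : Fin n) → x ∉ p - x
x∉p-x (b ∷ p) zero    ()
x∉p-x (b ∷ p) (suc x) (there h) = x∉p-x p x h

∣p∣≡1+∣p-x∣ : {p : Subset n} {x : Fin n} → x ∈ p → ∣ p ∣ ≡ suc ∣ p - x ∣
∣p∣≡1+∣p-x∣ {p = _ ∷ p} here = cong (suc ∘ ∣_∣) (sym (p─⊥≡p p))
∣p∣≡1+∣p-x∣ {p = inside ∷ p}  (there h) = cong suc (∣p∣≡1+∣p-x∣ h)
∣p∣≡1+∣p-x∣ {p = outside ∷ p} (there h) = ∣p∣≡1+∣p-x∣ h

p⊆q∧∣p∣≡∣q∣⇒p≡q : {p q : Subset n} → p ⊆ q → ∣ p ∣ ≡ ∣ q ∣ → p ≡ q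
p⊆q∧∣p∣≡∣q∣⇒p≡q {p = p} p⊆q eq = ⊆-antisym p⊆q q⊆p
  where
  q⊆p : _ ⊆ p
  q⊆p {x} x∈q with x ∈? p
  ... | yes x∈p = x∈p
  ... | no  x∉p = contradiction eq (<⇒≢ (p⊂q⇒∣p∣<∣q∣ (p⊆q , x , x∈q , x∉p)))

y∈p-x⇒y≢x : {p : Subset n} {x y : Fin n} → y ∈ p - x → y ≢ x
y∈p-x⇒y≢x {p = p} {x} y∈ refl = x∉p-x p x y∈

∈-remove-swap : (C : Subset n) (x y : Fin n) →
                ⟦ x ∈? C ⟧ * ⟦ y ∈? (C - x) ⟧ ≡ ⟦ y ∈? C ⟧ * ⟦ x ∈? (C - y) ⟧
∈-remove-swap C x y = begin
  ⟦ x ∈? C ⟧ * ⟦ y ∈? (C - x) ⟧    ≡⟨ ⟦⟧-× (x ∈? C) (y ∈? (C - x)) ⟨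
  ⟦ (x ∈? C) ×-dec (y ∈? (C - x)) ⟧ ≡⟨ ⟦⟧-cong ((x ∈? C) ×-dec (y ∈? (C - x))) ((y ∈? C) ×-dec (x ∈? (C - y))) (swap x y) (swap y x) ⟩
  ⟦ (y ∈? C) ×-dec (x ∈? (C - y)) ⟧ ≡⟨ ⟦⟧-× (y ∈? C) (x ∈? (C - y)) ⟩
  ⟦ y ∈? C ⟧ * ⟦ x ∈? (C - y) ⟧    ∎
  where
  open ≡-Reasoning
  swap : ∀ x y → x ∈ C × y ∈ C - x → y ∈ C × x ∈ C - y
  swap x y (x∈C , y∈) = p─q⊆p C _ y∈ , x∈p∧x≢y⇒x∈p-y x∈C (≢-sym (y∈p-x⇒y≢x y∈))

-- Weighting all of `Fin n` by an indicator keeps the index list of an inner sum fixed even when its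
-- set is `C - x`, so that `∑-swap` applies to nested sums.
∑∈ : Subset n → (Fin n → ℕ) → ℕ
∑∈ {n} C f = ∑ (allFin n) (λ x → ⟦ x ∈? C ⟧ * f x)

∑∈-mono : (C : Subset n) {f g : Fin n → ℕ} → (∀ x → x ∈ C → f x ≤ g x) → ∑∈ C f ≤ ∑∈ C g
∑∈-mono {n} C {f} {g} h = ∑-mono (allFin n) λ {x} _ → term x
  where
  term : ∀ x → ⟦ x ∈? C ⟧ * f x ≤ ⟦ x ∈? C ⟧ * g x
  term x with x ∈? C
  ... | yes x∈C = *-monoʳ-≤ 1 (h x x∈C)
  ... | no _    = z≤n

∑∈-cong : (C : Subset n) {f g : Fin n → ℕ} → (∀ x → x ∈ C → f x ≡ g x) → ∑∈ C f ≡ ∑∈ C g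
∑∈-cong C h = ≤-antisym (∑∈-mono C λ x → ≤-reflexive ∘ h x) (∑∈-mono C λ x → ≤-reflexive ∘ sym ∘ h x)

∑∈-const : (C : Subset n) (c : ℕ) → ∑∈ C (λ _ → c) ≡ ∣ C ∣ * c
∑∈-const {n} C c = trans (∑-*ʳ (allFin n) c _) (cong (_* c) (∑⟦∈⟧≡∣∣ C))

∑∈-+ : (C : Subset n) (f g : Fin n → ℕ) → ∑∈ C (λ x → f x + g x) ≡ ∑∈ C f + ∑∈ C g
∑∈-+ {n} C f g = trans (∑-cong (allFin n) λ x → *-distribˡ-+ ⟦ x ∈? C ⟧ (f x) (g x)) (∑-+ (allFin n) _ _)

∑∈-*ˡ : (C : Subset n) (c : ℕ) (f : Fin n → ℕ) → ∑∈ C (λ x → c * f x) ≡ c * ∑∈ C f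
∑∈-*ˡ {n} C c f = trans (∑-cong (allFin n) λ x → x∙yz≈y∙xz ⟦ x ∈? C ⟧ c (f x)) (∑-*ˡ (allFin n) c _)
  where
  x∙yz≈y∙xz : ∀ x y z → x * (y * z) ≡ y * (x * z)
  x∙yz≈y∙xz = solve-∀

∑∈-swap : (C : Subset n) (f : Fin n → Fin n → ℕ) →
          ∑∈ C (λ x → ∑∈ (C - x) (λ y → f x y)) ≡ ∑∈ C (λ y → ∑∈ (C - y) (λ x → f x y))
∑∈-swap {n} C f = begin
  ∑ N (λ x → ⟦ x ∈? C ⟧ * ∑ N (λ y → ⟦ y ∈? (C - x) ⟧ * f x y))
    ≡⟨ ∑-cong N (λ x → sym (∑-*ˡ N ⟦ x ∈? C ⟧ _)) ⟩
  ∑ N (λ x → ∑ N (λ y → ⟦ x ∈? C ⟧ * (⟦ y ∈? (C - x) ⟧ * f x y)))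
    ≡⟨ ∑-swap N N _ ⟩
  ∑ N (λ y → ∑ N (λ x → ⟦ x ∈? C ⟧ * (⟦ y ∈? (C - x) ⟧ * f x y)))
    ≡⟨ ∑-cong N (λ y → ∑-cong N λ x → exchange x y) ⟩
  ∑ N (λ y → ∑ N (λ x → ⟦ y ∈? C ⟧ * (⟦ x ∈? (C - y) ⟧ * f x y)))
    ≡⟨ ∑-cong N (λ y → ∑-*ˡ N ⟦ y ∈? C ⟧ _) ⟩
  ∑ N (λ y → ⟦ y ∈? C ⟧ * ∑ N (λ x → ⟦ x ∈? (C - y) ⟧ * f x y)) ∎
  where
  open ≡-Reasoning
  N = allFin n
  exchange : ∀ x y → ⟦ x ∈? C ⟧ * (⟦ y ∈? (C - x) ⟧ * f x y) ≡ ⟦ y ∈? C ⟧ * (⟦ x ∈? (C - y) ⟧ * f x y)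
  exchange x y = begin
    ⟦ x ∈? C ⟧ * (⟦ y ∈? (C - x) ⟧ * f x y) ≡⟨ *-assoc ⟦ x ∈? C ⟧ _ _ ⟨
    ⟦ x ∈? C ⟧ * ⟦ y ∈? (C - x) ⟧ * f x y   ≡⟨ cong (_* f x y) (∈-remove-swap C x y) ⟩
    ⟦ y ∈? C ⟧ * ⟦ x ∈? (C - y) ⟧ * f x y   ≡⟨ *-assoc ⟦ y ∈? C ⟧ _ _ ⟩
    ⟦ y ∈? C ⟧ * (⟦ x ∈? (C - y) ⟧ * f x y) ∎

-- Orderings of a set

infixl 5 _⊖_
_⊖_ : Subset n → List (Fin n) → Subset n
C ⊖ []       = C
C ⊖ (x ∷ xs) = C - x ⊖ xs

⊖-⊆ : (C : Subset n) (xs : List (Fin n)) → C ⊖ xs ⊆ C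
⊖-⊆ C []       = ⊆-refl
⊖-⊆ C (x ∷ xs) = ⊆-trans (⊖-⊆ (C - x) xs) (p─q⊆p C _)

⊖-++ : (C : Subset n) (xs ys : List (Fin n)) → C ⊖ (xs ++ ys) ≡ C ⊖ xs ⊖ ys
⊖-++ C []       ys = refl
⊖-++ C (x ∷ xs) ys = ⊖-++ (C - x) xs ys

∈-⊖⁺ : {C : Subset n} (xs : List (Fin n)) {x : Fin n} → x ∈ C → ¬ (x L.∈ xs) → x ∈ C ⊖ xs
∈-⊖⁺ []       x∈C x∉xs = x∈C
∈-⊖⁺ (y ∷ xs) x∈C x∉xs = ∈-⊖⁺ xs (x∈p∧x≢y⇒x∈p-y x∈C (x∉xs ∘ Any.here)) (x∉xs ∘ Any.there)

∈-⊖⁻ : (C : Subset n) (xs : List (Fin n)) {x : Fin n} → x ∈ C ⊖ xs → ¬ (x L.∈ xs)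
∈-⊖⁻ C (y ∷ xs) x∈ (Any.here refl) = x∉p-x C y (⊖-⊆ (C - y) xs x∈)
∈-⊖⁻ C (y ∷ xs) x∈ (Any.there x∈xs) = ∈-⊖⁻ (C - y) xs x∈ x∈xs

-- Turns a chain from `C` down to `B` into one from `A` down to `A ∩ B`; the count for pairs of sets
-- rests on this.
⊖-∩ : {A C : Subset n} → A ⊆ C → (xs : List (Fin n)) → A ⊖ xs ≡ A ∩ (C ⊖ xs)
⊖-∩ {A = A} {C} A⊆C xs = ⊆-antisym
  (λ x∈ → x∈p∩q⁺ (⊖-⊆ A xs x∈ , ∈-⊖⁺ xs (A⊆C (⊖-⊆ A xs x∈)) (∈-⊖⁻ A xs x∈)))
  (λ x∈ → let (x∈A , x∈C⊖xs) = x∈p∩q⁻ A (C ⊖ xs) x∈ in ∈-⊖⁺ xs x∈A (∈-⊖⁻ C xs x∈C⊖xs))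

-- The lists over which `∑ₒ` runs. `∑ₒ-mono` hands this evidence to the pointwise comparison, which
-- thereby knows the length of the list and that no element repeats.
data Ordering {n : ℕ} : ℕ → Subset n → List (Fin n) → Set where
  []  : ∀ {C} → Ordering 0 C []
  _∷_ : ∀ {k C x xs} → x ∈ C → Ordering k (C - x) xs → Ordering (suc k) C (x ∷ xs)

Ordering-length : ∀ {k} {C : Subset n} {xs} → Ordering k C xs → length xs ≡ k
Ordering-length []      = refl
Ordering-length (_ ∷ o) = cong suc (Ordering-length o)

Ordering-drop : ∀ {k} {C : Subset n} {xs} i → Ordering k C xs → Ordering (k ∸ i) (C ⊖ take i xs) (drop i xs)
Ordering-drop zero    o        = o
Ordering-drop (suc i) []       = []
Ordering-drop (suc i) (_ ∷ o)  = Ordering-drop i o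

Ordering-∈ : ∀ {k} {C : Subset n} {xs x} → Ordering k C xs → x L.∈ xs → x ∈ C
Ordering-∈ (x∈C ∷ o) (Any.here refl)  = x∈C
Ordering-∈ {C = C} (_ ∷ o) (Any.there x∈xs) = p─q⊆p C _ (Ordering-∈ o x∈xs)

-- For k = ∣ C ∣ the summation runs over the maximal chains from C down to ∅, each given by the order
-- in which the elements are removed.
∑ₒ : ℕ → Subset n → (List (Fin n) → ℕ) → ℕ
∑ₒ zero    C f = f []
∑ₒ (suc k) C f = ∑∈ C (λ x → ∑ₒ k (C - x) (f ∘ (x ∷_)))

∑ₒ-mono : ∀ k (C : Subset n) {f g : List (Fin n) → ℕ} → (∀ {xs} → Ordering k C xs → f xs ≤ g xs) → ∑ₒ k C f ≤ ∑ₒ k C g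
∑ₒ-mono zero    C h = h []
∑ₒ-mono (suc k) C h = ∑∈-mono C λ x x∈C → ∑ₒ-mono k (C - x) (h ∘ (x∈C ∷_))

∑ₒ-cong : ∀ k (C : Subset n) {f g : List (Fin n) → ℕ} → (∀ {xs} → Ordering k C xs → f xs ≡ g xs) → ∑ₒ k C f ≡ ∑ₒ k C g
∑ₒ-cong k C h = ≤-antisym (∑ₒ-mono k C (≤-reflexive ∘ h)) (∑ₒ-mono k C (≤-reflexive ∘ sym ∘ h))

∑ₒ-+ : ∀ k (C : Subset n) (f g : List (Fin n) → ℕ) → ∑ₒ k C (λ xs → f xs + g xs) ≡ ∑ₒ k C f + ∑ₒ k C g
∑ₒ-+ zero    C f g = refl
∑ₒ-+ (suc k) C f g =
  trans (∑∈-cong C λ x _ → ∑ₒ-+ k (C - x) (f ∘ (x ∷_)) (g ∘ (x ∷_))) (∑∈-+ C _ _)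

∑ₒ-*ˡ : ∀ k (C : Subset n) c (f : List (Fin n) → ℕ) → ∑ₒ k C (λ xs → c * f xs) ≡ c * ∑ₒ k C f
∑ₒ-*ˡ zero    C c f = refl
∑ₒ-*ˡ (suc k) C c f =
  trans (∑∈-cong C λ x _ → ∑ₒ-*ˡ k (C - x) c (f ∘ (x ∷_))) (∑∈-*ˡ C c _)

∑ₒ-1 : ∀ k (C : Subset n) → ∣ C ∣ ≡ k → ∑ₒ k C (λ _ → 1) ≡ k !
∑ₒ-1 zero    C eq = refl
∑ₒ-1 (suc k) C eq = begin
  ∑∈ C (λ x → ∑ₒ k (C - x) (λ _ → 1))
    ≡⟨ ∑∈-cong C (λ x x∈C → ∑ₒ-1 k (C - x) (suc-injective (trans (sym (∣p∣≡1+∣p-x∣ x∈C)) eq))) ⟩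
  ∑∈ C (λ _ → k !) ≡⟨ ∑∈-const C (k !) ⟩
  ∣ C ∣ * k !      ≡⟨ cong (_* k !) eq ⟩
  suc k * k !      ∎
  where open ≡-Reasoning

∑ₒ-0 : ∀ k (C : Subset n) → ∑ₒ k C (λ _ → 0) ≡ 0
∑ₒ-0 k C = ∑ₒ-*ˡ k C 0 (λ _ → 0)

∑ₒ-∑ : ∀ k (C : Subset n) (ys : List Y) (f : Y → List (Fin n) → ℕ) →
       ∑ₒ k C (λ xs → ∑ ys (λ y → f y xs)) ≡ ∑ ys (λ y → ∑ₒ k C (f y))
∑ₒ-∑ k C []       f = ∑ₒ-0 k C
∑ₒ-∑ k C (y ∷ ys) f =
  trans (∑ₒ-+ k C (f y) (λ xs → ∑ ys (λ y → f y xs))) (cong (∑ₒ k C (f y) +_) (∑ₒ-∑ k C ys f))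

-- The source of rotation invariance: choosing the last element before all others gives the same
-- sum, because two successive choices commute (`∑∈-swap`).
∑ₒ-last : ∀ k (C : Subset n) (f : List (Fin n) → ℕ) →
          ∑ₒ (suc k) C f ≡ ∑∈ C (λ x → ∑ₒ k (C - x) (λ xs → f (xs ∷ʳ x)))
∑ₒ-last zero    C f = refl
∑ₒ-last (suc k) C f = begin
  ∑∈ C (λ x → ∑ₒ (suc k) (C - x) (f ∘ (x ∷_)))
    ≡⟨ ∑∈-cong C (λ x _ → ∑ₒ-last k (C - x) (f ∘ (x ∷_))) ⟩
  ∑∈ C (λ x → ∑∈ (C - x) (λ y → ∑ₒ k (C - x - y) (λ xs → f (x ∷ xs ∷ʳ y))))
    ≡⟨ ∑∈-swap C _ ⟩
  ∑∈ C (λ y → ∑∈ (C - y) (λ x → ∑ₒ k (C - x - y) (λ xs → f (x ∷ xs ∷ʳ y))))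
    ≡⟨ ∑∈-cong C (λ y _ → ∑∈-cong (C - y) λ x _ → cong (λ D → ∑ₒ k D (λ xs → f (x ∷ xs ∷ʳ y))) (p─x─y≡p─y─x C x y)) ⟩
  ∑∈ C (λ y → ∑∈ (C - y) (λ x → ∑ₒ k (C - y - x) (λ xs → f (x ∷ xs ∷ʳ y)))) ∎
  where open ≡-Reasoning

-- Phrased by appending, since a rotation moves the first element of an ordering to its end.
DependsOnFirst : ℕ → (List X → ℕ) → Set
DependsOnFirst l f = ∀ xs ys → l ≤ length xs → f (xs ++ ys) ≡ f xs

drop-dependsOnFirst : ∀ a {l} {f : List X → ℕ} → DependsOnFirst l f → DependsOnFirst (a + l) (f ∘ drop a)
drop-dependsOnFirst zero    dep xs       ys l≤      = dep xs ys l≤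
drop-dependsOnFirst (suc a) dep (x ∷ xs) ys (s≤s l≤) = drop-dependsOnFirst a dep xs ys l≤

-- Rotating an ordering by a places brings its block at offset a to the front.
∑ₒ-drop : ∀ a {l} k (C : Subset n) {f : List (Fin n) → ℕ} → DependsOnFirst l f → a + l ≤ k →
          ∑ₒ k C (f ∘ drop a) ≡ ∑ₒ k C f
∑ₒ-drop zero    k       C dep a+l≤k = refl
∑ₒ-drop (suc a) (suc k) C {f} dep (s≤s a+l≤k) = begin
  ∑∈ C (λ x → ∑ₒ k (C - x) (f ∘ drop a))
    ≡⟨ ∑∈-cong C (λ x _ → ∑ₒ-cong k (C - x) λ {xs} o →
         sym (drop-dependsOnFirst a dep xs (x ∷ []) (subst (_ ≤_) (sym (Ordering-length o)) a+l≤k))) ⟩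
  ∑∈ C (λ x → ∑ₒ k (C - x) (λ xs → f (drop a (xs ∷ʳ x))))
    ≡⟨ ∑ₒ-last k C (f ∘ drop a) ⟨
  ∑ₒ (suc k) C (f ∘ drop a)
    ≡⟨ ∑ₒ-drop a (suc k) C dep (m≤n⇒m≤1+n a+l≤k) ⟩
  ∑ₒ (suc k) C f ∎
  where open ≡-Reasoning

-- The first `i` elements have to be those of `C` outside `A`, in any of `i !` orders; after them
-- the ordering runs freely through `A`.
∑ₒ-prefix : ∀ i j {A C : Subset n} (g : List (Fin n) → ℕ) → A ⊆ C → ∣ C ∣ ≡ i + ∣ A ∣ →
            ∑ₒ (i + j) C (λ xs → ⟦ (C ⊖ take i xs) ≟ₛ A ⟧ * g (drop i xs)) ≡ i ! * ∑ₒ j A g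
∑ₒ-prefix zero j {A} {C} g A⊆C eq with refl ← p⊆q∧∣p∣≡∣q∣⇒p≡q A⊆C (sym eq) =
  trans (∑ₒ-cong j A λ {xs} _ → cong (_* g xs) (⟦⟧-yes (A ≟ₛ A) refl)) (∑ₒ-*ˡ j A 1 g)
-- Only a first element outside `A` contributes. Adding `∣ A ∣ * T` to both sides gives each element
-- of `A` a share `T` as well, so that the sum over `C` becomes constant and no sum over a
-- difference of sets is needed.
∑ₒ-prefix {n} (suc i) j {A} {C} g A⊆C eq = +-cancelʳ-≡ (∣ A ∣ * T) _ _ (begin
  ∑∈ C inner + ∣ A ∣ * T
    ≡⟨ cong (∑∈ C inner +_) (∑∈-const A T) ⟨
  ∑ N (λ x → ⟦ x ∈? C ⟧ * inner x) + ∑ N (λ x → ⟦ x ∈? A ⟧ * T)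
    ≡⟨ ∑-+ N _ _ ⟨
  ∑ N (λ x → ⟦ x ∈? C ⟧ * inner x + ⟦ x ∈? A ⟧ * T)
    ≡⟨ ∑-cong N term ⟩
  ∑∈ C (λ _ → T)
    ≡⟨ ∑∈-const C T ⟩
  ∣ C ∣ * T
    ≡⟨ cong (_* T) eq ⟩
  (suc i + ∣ A ∣) * T
    ≡⟨ *-distribʳ-+ T (suc i) ∣ A ∣ ⟩
  suc i * T + ∣ A ∣ * T
    ≡⟨ cong (_+ ∣ A ∣ * T) (*-assoc (suc i) (i !) (∑ₒ j A g)) ⟨
  suc i ! * ∑ₒ j A g + ∣ A ∣ * T ∎)
  where
  open ≡-Reasoning
  N = allFin n
  T = i ! * ∑ₒ j A g
  inner : Fin n → ℕ
  inner x = ∑ₒ (i + j) (C - x) (λ xs → ⟦ (C - x ⊖ take i xs) ≟ₛ A ⟧ * g (drop i xs))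
  vanish : ∀ x → x ∈ A → inner x ≡ 0
  vanish x x∈A = trans
    (∑ₒ-cong (i + j) (C - x) λ {xs} _ → cong (_* g (drop i xs))
      (⟦⟧-no ((C - x ⊖ take i xs) ≟ₛ A) λ { refl → x∉p-x C x (⊖-⊆ (C - x) (take i xs) x∈A) }))
    (∑ₒ-0 (i + j) (C - x))
  term : ∀ x → ⟦ x ∈? C ⟧ * inner x + ⟦ x ∈? A ⟧ * T ≡ ⟦ x ∈? C ⟧ * T
  term x with x ∈? C | x ∈? A
  ... | yes x∈C | yes x∈A = cong (λ z → 1 * z + 1 * T) (vanish x x∈A)
  ... | yes x∈C | no  x∉A = trans (+-identityʳ _) (cong (1 *_) (∑ₒ-prefix i j g
        (λ {y} y∈A → x∈p∧x≢y⇒x∈p-y (A⊆C y∈A) λ { refl → x∉A y∈A })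
        (suc-injective (trans (sym (∣p∣≡1+∣p-x∣ x∈C)) eq))))
  ... | no  x∉C | yes x∈A = contradiction (A⊆C x∈A) x∉C
  ... | no  x∉C | no  x∉A = refl

-- Chains meeting a family

take-+ : ∀ i k (xs : List X) → take (i + k) xs ≡ take i xs ++ take k (drop i xs)
take-+ zero    k xs       = refl
take-+ (suc i) k []       = sym (List.take-[] k)
take-+ (suc i) k (x ∷ xs) = cong (x ∷_) (take-+ i k xs)

⊖-take-drop : ∀ i k (xs : List (Fin n)) {A C : Subset n} → C ⊖ take i xs ≡ A → A ⊖ take k (drop i xs) ≡ C ⊖ take (i + k) xs
⊖-take-drop i k xs {C = C} refl = trans (sym (⊖-++ C (take i xs) _)) (cong (C ⊖_) (sym (take-+ i k xs)))

length-filter≡∑ : {P : Pred X 0ℓ} (P? : Decidable P) (xs : List X) → length (filter P? xs) ≡ ∑ xs (λ x → ⟦ P? x ⟧)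
length-filter≡∑ P? []       = refl
length-filter≡∑ P? (x ∷ xs) with does (P? x)
... | true  = cong suc (length-filter≡∑ P? xs)
... | false = length-filter≡∑ P? xs

∑⟦⟧≤1 : {P : Pred X 0ℓ} (P? : Decidable P) {xs : List X} → Unique xs →
        (∀ {x y} → x L.∈ xs → y L.∈ xs → P x → P y → x ≡ y) → ∑ xs (λ x → ⟦ P? x ⟧) ≤ 1
∑⟦⟧≤1 P? []                    h = z≤n
∑⟦⟧≤1 P? {x ∷ xs} (x∉xs ∷ u) h with P? x
... | no _   = ∑⟦⟧≤1 P? u (λ y∈ z∈ → h (Any.there y∈) (Any.there z∈))
... | yes px = s≤s (≤-trans (∑-mono xs λ {y} y∈ → ≤-reflexive (⟦⟧-no (P? y) λ py →
                 All.lookup x∉xs y∈ (h (Any.here refl) (Any.there y∈) px py))) (≤-reflexive (∑-zero xs)))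

-- The chain that removes xs from C passes through A.  If ∣ A ∣ ≥ ∣ C ∣, no element is removed and A must be C.
Reaches : Subset n → Subset n → List (Fin n) → Set
Reaches C A xs = C ⊖ take (∣ C ∣ ∸ ∣ A ∣) xs ≡ A

reaches? : (C A : Subset n) (xs : List (Fin n)) → Dec (Reaches C A xs)
reaches? C A xs = (C ⊖ take (∣ C ∣ ∸ ∣ A ∣) xs) ≟ₛ A

-- A chain below `C` starts at `C`, so without `A ≢ C` every member of `L` would be hit from itself.
Hits : List (Subset n) → Subset n → List (Fin n) → Set
Hits L C xs = Any (λ A → A ≢ C × Reaches C A xs) L

hits? : (L : List (Subset n)) (C : Subset n) (xs : List (Fin n)) → Dec (Hits L C xs)
hits? L C xs = any? (λ A → ¬? (A ≟ₛ C) ×-dec reaches? C A xs) L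

hitCount missCount : List (Subset n) → Subset n → ℕ
hitCount  L C = ∑ₒ (∣ C ∣) C (λ xs → ⟦ hits? L C xs ⟧)
missCount L C = ∑ₒ (∣ C ∣) C (λ xs → ⟦ ¬? (hits? L C xs) ⟧)

hit+miss≡! : (L : List (Subset n)) (C : Subset n) → hitCount L C + missCount L C ≡ ∣ C ∣ !
hit+miss≡! L C = begin
  hitCount L C + missCount L C
    ≡⟨ ∑ₒ-+ (∣ C ∣) C _ _ ⟨
  ∑ₒ (∣ C ∣) C (λ xs → ⟦ hits? L C xs ⟧ + ⟦ ¬? (hits? L C xs) ⟧)
    ≡⟨ ∑ₒ-cong (∣ C ∣) C (λ {xs} _ → complement (hits? L C xs)) ⟩
  ∑ₒ (∣ C ∣) C (λ _ → 1)
    ≡⟨ ∑ₒ-1 (∣ C ∣) C refl ⟩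
  ∣ C ∣ ! ∎
  where
  open ≡-Reasoning
  complement : {P : Set} (d : Dec P) → ⟦ d ⟧ + ⟦ ¬? d ⟧ ≡ 1
  complement (yes _) = refl
  complement (no _)  = refl

-- Along a maximal chain only the lowest member of L has no member of L below it.
lym : {L : List (Subset n)} → Unique L → ∑ L (λ A → (n ∸ ∣ A ∣) ! * missCount L A) ≤ n !
lym {n} {L} uniq = begin
  ∑ L (λ A → (n ∸ ∣ A ∣) ! * missCount L A)
    ≡⟨ ∑-cong L count ⟩
  ∑ L (λ A → ∑ₒ n ⊤ (λ xs → ⟦ lowest? xs A ⟧))
    ≡⟨ ∑ₒ-∑ n ⊤ L (λ A xs → ⟦ lowest? xs A ⟧) ⟨
  ∑ₒ n ⊤ (λ xs → ∑ L (λ A → ⟦ lowest? xs A ⟧))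
    ≤⟨ ∑ₒ-mono n ⊤ (λ {xs} _ → ∑⟦⟧≤1 (lowest? xs) uniq (lowest-unique xs)) ⟩
  ∑ₒ n ⊤ (λ _ → 1)
    ≡⟨ ∑ₒ-1 n ⊤ (∣⊤∣≡n n) ⟩
  n ! ∎
  where
  open ≤-Reasoning
  Lowest : List (Fin n) → Subset n → Set
  Lowest xs A = ⊤ ⊖ take (n ∸ ∣ A ∣) xs ≡ A × ¬ Hits L A (drop (n ∸ ∣ A ∣) xs)
  lowest? : ∀ xs A → Dec (Lowest xs A)
  lowest? xs A = ((⊤ ⊖ take (n ∸ ∣ A ∣) xs) ≟ₛ A) ×-dec ¬? (hits? L A (drop (n ∸ ∣ A ∣) xs))
  -- A maximal chain through `A` is an order of the complement of `A` followed by a chain below `A`,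
  -- and missing `L` concerns only the second part.
  count : ∀ A → (n ∸ ∣ A ∣) ! * missCount L A ≡ ∑ₒ n ⊤ (λ xs → ⟦ lowest? xs A ⟧)
  count A = begin-equality
    (n ∸ ∣ A ∣) ! * missCount L A
      ≡⟨ ∑ₒ-prefix (n ∸ ∣ A ∣) (∣ A ∣) (λ xs → ⟦ ¬? (hits? L A xs) ⟧) ⊆⊤ (trans (∣⊤∣≡n n) (sym (m∸n+n≡m (∣p∣≤n A)))) ⟨
    ∑ₒ (n ∸ ∣ A ∣ + ∣ A ∣) ⊤ product
      ≡⟨ cong (λ k → ∑ₒ k ⊤ product) (m∸n+n≡m (∣p∣≤n A)) ⟩
    ∑ₒ n ⊤ product
      ≡⟨ ∑ₒ-cong n ⊤ (λ {xs} _ → ⟦⟧-× ((⊤ ⊖ take (n ∸ ∣ A ∣) xs) ≟ₛ A) (¬? (hits? L A (drop (n ∸ ∣ A ∣) xs)))) ⟨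
    ∑ₒ n ⊤ (λ xs → ⟦ lowest? xs A ⟧) ∎
    where
    product : List (Fin n) → ℕ
    product xs = ⟦ (⊤ ⊖ take (n ∸ ∣ A ∣) xs) ≟ₛ A ⟧ * ⟦ ¬? (hits? L A (drop (n ∸ ∣ A ∣) xs)) ⟧
  below : ∀ xs {A B} → A L.∈ L → B L.∈ L → Lowest xs A → Lowest xs B → ∣ B ∣ ≤ ∣ A ∣ → A ≡ B
  below xs {A} {B} A∈L B∈L (reachA , ¬hitA) (reachB , _) B≤A with A ≟ₛ B
  ... | yes A≡B = A≡B
  ... | no  A≢B = contradiction (L.lose B∈L (≢-sym A≢B , reach)) ¬hitA
    where
    i = n ∸ ∣ A ∣
    k = ∣ A ∣ ∸ ∣ B ∣
    reach : Reaches A B (drop i xs)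
    reach = trans (⊖-take-drop i k xs reachA) (trans (cong (λ j → ⊤ ⊖ take j xs) i+k≡) reachB)
      where
      i+k≡ : i + k ≡ n ∸ ∣ B ∣
      i+k≡ = trans (sym (+-∸-assoc i B≤A)) (cong (_∸ ∣ B ∣) (m∸n+n≡m (∣p∣≤n A)))
  lowest-unique : ∀ xs {A B} → A L.∈ L → B L.∈ L → Lowest xs A → Lowest xs B → A ≡ B
  lowest-unique xs {A} {B} A∈L B∈L lowA lowB with ≤-total (∣ B ∣) (∣ A ∣)
  ... | inj₁ B≤A = below xs A∈L B∈L lowA lowB B≤A
  ... | inj₂ A≤B = sym (below xs B∈L A∈L lowB lowA A≤B)

-- Binomial coefficients and the tails of a family

C-!-! : ∀ {n k} → k ≤ n → n choose k * (k ! * (n ∸ k) !) ≡ n !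
C-!-! {n} {k} k≤n = trans (cong (_* (k ! * (n ∸ k) !)) (nCk≡n!/k![n-k]! k≤n)) (m/n*n≡m (k![n∸k]!∣n! k≤n))
  where instance _ = k !* (n ∸ k) !≢0

C-step : ∀ {n k} → k < n → n choose suc k * suc k ≡ n choose k * (n ∸ k)
C-step {n} {k} k<n = *-cancelʳ-≡ _ _ (k ! * (n ∸ suc k) !) {{k !* (n ∸ suc k) !≢0}} (begin
  n choose suc k * suc k * (k ! * (n ∸ suc k) !)
    ≡⟨ solveˡ (n choose suc k) (suc k) (k !) ((n ∸ suc k) !) ⟩
  n choose suc k * (suc k ! * (n ∸ suc k) !)
    ≡⟨ C-!-! k<n ⟩
  n !
    ≡⟨ C-!-! (<⇒≤ k<n) ⟨
  n choose k * (k ! * (n ∸ k) !)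
    ≡⟨ cong (λ z → n choose k * (k ! * z !)) n∸k≡ ⟩
  n choose k * (k ! * (suc (n ∸ suc k) * (n ∸ suc k) !))
    ≡⟨ solveʳ (n choose k) (k !) (suc (n ∸ suc k)) ((n ∸ suc k) !) ⟩
  n choose k * suc (n ∸ suc k) * (k ! * (n ∸ suc k) !)
    ≡⟨ cong (λ z → n choose k * z * (k ! * (n ∸ suc k) !)) n∸k≡ ⟨
  n choose k * (n ∸ k) * (k ! * (n ∸ suc k) !) ∎)
  where
  open ≡-Reasoning
  n∸k≡ : n ∸ k ≡ suc (n ∸ suc k)
  n∸k≡ = +-∸-assoc 1 k<n
  solveˡ : ∀ a b c d → a * b * (c * d) ≡ a * (b * c * d)
  solveˡ = solve-∀
  solveʳ : ∀ a b c d → a * (b * (c * d)) ≡ a * c * (b * d)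
  solveʳ = solve-∀

n≤1+2[n/2] : ∀ n → n ≤ suc (n / 2 + n / 2)
n≤1+2[n/2] n = begin
  n                    ≡⟨ m≡m%n+[m/n]*n n 2 ⟩
  n % 2 + n / 2 * 2    ≤⟨ +-monoˡ-≤ _ (≤-pred (m%n<n n 2)) ⟩
  1 + n / 2 * 2        ≡⟨ cong suc (trans (*-comm (n / 2) 2) (cong (n / 2 +_) (+-identityʳ (n / 2)))) ⟩
  suc (n / 2 + n / 2)  ∎
  where open ≤-Reasoning

2[n/2]≤n : ∀ n → n / 2 + n / 2 ≤ n
2[n/2]≤n n = begin
  n / 2 + n / 2      ≡⟨ trans (*-comm (n / 2) 2) (cong (n / 2 +_) (+-identityʳ (n / 2))) ⟨
  n / 2 * 2          ≤⟨ m≤n+m _ (n % 2) ⟩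
  n % 2 + n / 2 * 2  ≡⟨ m≡m%n+[m/n]*n n 2 ⟨
  n                  ∎
  where open ≤-Reasoning

C-suc≤ : ∀ {n k} → n / 2 ≤ k → n choose suc k ≤ n choose k
C-suc≤ {n} {k} h≤k with k <? n
... | no  k≮n = subst (_≤ n choose k) (sym (k>n⇒nCk≡0 (s≤s (≮⇒≥ k≮n)))) z≤n
... | yes k<n = *-cancelʳ-≤ _ _ (suc k) (begin
  n choose suc k * suc k ≡⟨ C-step k<n ⟩
  n choose k * (n ∸ k)   ≤⟨ *-monoʳ-≤ (n choose k) (m≤n+o⇒m∸n≤o n k n≤) ⟩
  n choose k * suc k     ∎)
  where
  open ≤-Reasoning
  n≤ : n ≤ k + suc k
  n≤ = begin
    n                   ≤⟨ n≤1+2[n/2] n ⟩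
    suc (n / 2 + n / 2) ≤⟨ s≤s (+-mono-≤ h≤k h≤k) ⟩
    suc (k + k)         ≡⟨ +-suc k k ⟨
    k + suc k           ∎

C-upper≤central : ∀ n d → n choose (n / 2 + d) ≤ n choose (n / 2)
C-upper≤central n zero    = ≤-reflexive (cong (n choose_) (+-identityʳ (n / 2)))
C-upper≤central n (suc d) = ≤-trans
  (subst (λ k → n choose k ≤ n choose (n / 2 + d)) (sym (+-suc (n / 2) d)) (C-suc≤ (m≤m+n (n / 2) d)))
  (C-upper≤central n d)

C≤central : ∀ {n k} → k ≤ n → n choose k ≤ n choose (n / 2)
C≤central {n} {k} k≤n with n / 2 ≤? k
... | yes h≤k = subst (λ j → n choose j ≤ n choose (n / 2)) (m+[n∸m]≡n h≤k) (C-upper≤central n (k ∸ n / 2))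
... | no  h≰k = begin
  n choose k                              ≡⟨ nCk≡nC[n∸k] k≤n ⟩
  n choose (n ∸ k)                        ≡⟨ cong (n choose_) (m+[n∸m]≡n h≤n∸k) ⟨
  n choose (n / 2 + (n ∸ k ∸ n / 2))      ≤⟨ C-upper≤central n (n ∸ k ∸ n / 2) ⟩
  n choose (n / 2)                        ∎
  where
  open ≤-Reasoning
  h≤n∸k : n / 2 ≤ n ∸ k
  h≤n∸k = m+n≤o⇒m≤o∸n (n / 2) (≤-trans (+-monoʳ-≤ (n / 2) (<⇒≤ (≰⇒> h≰k))) (2[n/2]≤n n))

central>0 : ∀ n → 0 < n choose (n / 2)
central>0 n = ≤-trans (s≤s z≤n) (C≤central {n} {0} z≤n)

n!≤central*!*! : (A : Subset n) → n ! ≤ n choose (n / 2) * (∣ A ∣ ! * (n ∸ ∣ A ∣) !)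
n!≤central*!*! A = ≤-trans (≤-reflexive (sym (C-!-! (∣p∣≤n A)))) (*-monoˡ-≤ _ (C≤central (∣p∣≤n A)))

-- Sets of equal size form an antichain, so every chain below a member misses the others, and `lym`
-- then bounds their number by the binomial coefficient.
layer-bound : ∀ {L : List (Subset n)} j → j ≤ n → Unique L → (∀ {A} → A L.∈ L → ∣ A ∣ ≡ j) → length L ≤ n choose j
layer-bound {n} {L} j j≤n uniq size = *-cancelʳ-≤ _ _ (j ! * (n ∸ j) !) {{j !* (n ∸ j) !≢0}} (begin
  length L * (j ! * (n ∸ j) !)
    ≡⟨ ∑-const L _ ⟨
  ∑ L (λ _ → j ! * (n ∸ j) !)
    ≤⟨ ∑-mono L (λ {A} A∈L → ≤-reflexive (term A∈L)) ⟩
  ∑ L (λ A → (n ∸ ∣ A ∣) ! * missCount L A)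
    ≤⟨ lym uniq ⟩
  n !
    ≡⟨ C-!-! j≤n ⟨
  n choose j * (j ! * (n ∸ j) !) ∎)
  where
  open ≤-Reasoning
  miss : ∀ {A} → A L.∈ L → missCount L A ≡ ∣ A ∣ !
  miss {A} A∈L = trans (∑ₒ-cong (∣ A ∣) A λ {xs} _ → ⟦⟧-yes (¬? (hits? L A xs)) (noHit xs)) (∑ₒ-1 (∣ A ∣) A refl)
    where
    noHit : ∀ xs → ¬ Hits L A xs
    noHit xs hit with B , B∈L , (B≢A , reach) ← L.find hit =
      B≢A (trans (sym reach) (cong (λ i → A ⊖ take i xs) (m≤n⇒m∸n≡0 (≤-reflexive (trans (size A∈L) (sym (size B∈L)))))))
  term : ∀ {A} → A L.∈ L → j ! * (n ∸ j) ! ≡ (n ∸ ∣ A ∣) ! * missCount L A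
  term {A} A∈L = trans (*-comm (j !) _) (cong₂ _*_ (cong (λ k → (n ∸ k) !) (sym (size A∈L)))
    (trans (cong _! (sym (size A∈L))) (sym (miss A∈L))))

upperTail : List (Subset n) → ℕ → ℕ
upperTail L k = length (filter (λ A → k ≤? ∣ A ∣) L)

-- A ratio d/(d+1) between consecutive binomials bounds the tail by a geometric series.
upperTail-bound : ∀ {L : List (Subset n)} d k₀ → Unique L →
                  (∀ k → k₀ ≤ k → n choose suc k * suc d ≤ n choose k * d) →
                  ∀ t k → k₀ ≤ k → k + t ≡ suc n → upperTail L k ≤ suc d * n choose k
upperTail-bound {n} {L} d k₀ uniq ratio zero k k₀≤k k≡ = begin
  upperTail L k                    ≡⟨ length-filter≡∑ (λ A → k ≤? ∣ A ∣) L ⟩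
  ∑ L (λ A → ⟦ k ≤? ∣ A ∣ ⟧)       ≡⟨ ∑-cong L (λ A → ⟦⟧-no (k ≤? ∣ A ∣) (tooLarge A)) ⟩
  ∑ L (λ _ → 0)                    ≡⟨ ∑-zero L ⟩
  0                                ≤⟨ z≤n ⟩
  suc d * n choose k                    ∎
  where
  open ≤-Reasoning
  tooLarge : ∀ (A : Subset n) → ¬ k ≤ ∣ A ∣
  tooLarge A k≤ = <⇒≱ (n<1+n n) (subst (_≤ n) (trans (sym (+-identityʳ k)) k≡) (≤-trans k≤ (∣p∣≤n A)))
upperTail-bound {n} {L} d k₀ uniq ratio (suc t) k k₀≤k k≡ = begin
  upperTail L k
    ≡⟨ length-filter≡∑ (λ A → k ≤? ∣ A ∣) L ⟩
  ∑ L (λ A → ⟦ k ≤? ∣ A ∣ ⟧)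
    ≤⟨ ∑-mono L (λ {A} _ → split A) ⟩
  ∑ L (λ A → ⟦ ∣ A ∣ ≟ k ⟧ + ⟦ suc k ≤? ∣ A ∣ ⟧)
    ≡⟨ ∑-+ L _ _ ⟩
  ∑ L (λ A → ⟦ ∣ A ∣ ≟ k ⟧) + ∑ L (λ A → ⟦ suc k ≤? ∣ A ∣ ⟧)
    ≡⟨ cong₂ _+_ (length-filter≡∑ (λ A → ∣ A ∣ ≟ k) L) (length-filter≡∑ (λ A → suc k ≤? ∣ A ∣) L) ⟨
  length (filter (λ A → ∣ A ∣ ≟ k) L) + upperTail L (suc k)
    ≤⟨ +-mono-≤
         (layer-bound k (m+n≤o⇒m≤o k (≤-reflexive (suc-injective (trans (sym (+-suc k t)) k≡))))
           (Unique.filter⁺ (λ A → ∣ A ∣ ≟ k) uniq) (λ A∈ → proj₂ (∈-filter⁻ (λ A → ∣ A ∣ ≟ k) {xs = L} A∈)))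
         (upperTail-bound d k₀ uniq ratio t (suc k) (m≤n⇒m≤1+n k₀≤k) (trans (sym (+-suc k t)) k≡)) ⟩
  n choose k + suc d * n choose suc k
    ≡⟨ cong (n choose k +_) (*-comm (suc d) (n choose suc k)) ⟩
  n choose k + n choose suc k * suc d
    ≤⟨ +-monoʳ-≤ (n choose k) (ratio k k₀≤k) ⟩
  n choose k + n choose k * d
    ≡⟨ cong (n choose k +_) (*-comm (n choose k) d) ⟩
  suc d * n choose k ∎
  where
  open ≤-Reasoning
  split : ∀ A → ⟦ k ≤? ∣ A ∣ ⟧ ≤ ⟦ ∣ A ∣ ≟ k ⟧ + ⟦ suc k ≤? ∣ A ∣ ⟧
  split A = ⟦⟧≤ (k ≤? ∣ A ∣) λ k≤ → case m≤n⇒m<n∨m≡n k≤ of λ where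
    (inj₁ k<)  → ≤-trans (1≤⟦⟧ (suc k ≤? ∣ A ∣) k<) (m≤n+m _ _)
    (inj₂ k≡A) → ≤-trans (1≤⟦⟧ (∣ A ∣ ≟ k) (sym k≡A)) (m≤m+n _ _)

-- Bernoulli's inequality for powers of (d+1)/d.
C-decay : ∀ {n} d k₀ → (∀ k → k₀ ≤ k → n choose suc k * suc d ≤ n choose k * d) →
          ∀ l → n choose (k₀ + l) * (suc d + l) ≤ suc d * n choose k₀
C-decay {n} d k₀ ratio zero = ≤-reflexive
  (trans (cong₂ _*_ (cong (n choose_) (+-identityʳ k₀)) (+-identityʳ (suc d))) (*-comm (n choose k₀) (suc d)))
C-decay {n} d k₀ ratio (suc l) = ≤-trans (*-cancelˡ-≤ (suc d) (begin
  suc d * (n choose (k₀ + suc l) * (suc d + suc l))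
    ≡⟨ cong (λ k → suc d * (n choose k * (suc d + suc l))) (+-suc k₀ l) ⟩
  suc d * (n choose suc (k₀ + l) * (suc d + suc l))
    ≡⟨ regroup (suc d) (n choose suc (k₀ + l)) (suc d + suc l) ⟩
  n choose suc (k₀ + l) * suc d * (suc d + suc l)
    ≤⟨ *-monoˡ-≤ (suc d + suc l) (ratio (k₀ + l) (m≤m+n k₀ l)) ⟩
  n choose (k₀ + l) * d * (suc d + suc l)
    ≤⟨ m≤m+n _ (n choose (k₀ + l) * suc l) ⟩
  n choose (k₀ + l) * d * (suc d + suc l) + n choose (k₀ + l) * suc l
    ≡⟨ expand (n choose (k₀ + l)) d l ⟩
  suc d * (n choose (k₀ + l) * (suc d + l)) ∎)) (C-decay d k₀ ratio l)
  where
  open ≤-Reasoning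
  regroup : ∀ a b c → a * (b * c) ≡ b * a * c
  regroup = solve-∀
  expand : ∀ x d l → x * d * (suc d + suc l) + x * suc l ≡ suc d * (x * (suc d + l))
  expand = solve-∀

-- Restriction to the middle layers

∁-injective : {A B : Subset n} → ∁ A ≡ ∁ B → A ≡ B
∁-injective eq = ⊆-antisym (∁p⊆∁q⇒p⊇q (⊆-reflexive (sym eq))) (∁p⊆∁q⇒p⊇q (⊆-reflexive eq))

-- The quotient of consecutive binomials is (n - k)/(k + 1). From `n / 2 + a` on, the numerator is
-- smaller than the denominator by at least 2a, and 2a ≥ n/(d + 1) ≥ (k + 1)/(d + 1) as long as k <
-- n.
C-ratio : ∀ {n} d a → n ≤ 2 * (suc d * a) → ∀ k → n / 2 + a ≤ k → n choose suc k * suc d ≤ n choose k * d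
C-ratio {n} d a n≤2ca k h+a≤k with k <? n
... | no  k≮n = ≤-trans (≤-reflexive (cong (_* suc d) (k>n⇒nCk≡0 (s≤s (≮⇒≥ k≮n))))) z≤n
... | yes k<n = *-cancelʳ-≤ _ _ (suc k) (begin
  n choose suc k * suc d * suc k   ≡⟨ swapʳ (n choose suc k) (suc d) (suc k) ⟩
  n choose suc k * suc k * suc d   ≡⟨ cong (_* suc d) (C-step k<n) ⟩
  n choose k * (n ∸ k) * suc d     ≡⟨ *-assoc (n choose k) (n ∸ k) (suc d) ⟩
  n choose k * ((n ∸ k) * suc d)   ≤⟨ *-monoʳ-≤ (n choose k) core ⟩
  n choose k * (d * suc k)         ≡⟨ *-assoc (n choose k) d (suc k) ⟨
  n choose k * d * suc k           ∎)
  where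
  open ≤-Reasoning
  swapʳ : ∀ x y z → x * y * z ≡ x * z * y
  swapʳ = solve-∀
  gap : n ∸ k + 2 * a ≤ suc k
  gap = +-cancelʳ-≤ k _ _ (begin
    n ∸ k + 2 * a + k               ≡⟨ rearrange₁ (n ∸ k) (2 * a) k ⟩
    n ∸ k + k + 2 * a               ≡⟨ cong (_+ 2 * a) (m∸n+n≡m (<⇒≤ k<n)) ⟩
    n + 2 * a                       ≤⟨ +-monoˡ-≤ (2 * a) (n≤1+2[n/2] n) ⟩
    suc (n / 2 + n / 2) + 2 * a     ≡⟨ rearrange₂ (n / 2) a ⟩
    suc ((n / 2 + a) + (n / 2 + a)) ≤⟨ s≤s (+-mono-≤ h+a≤k h+a≤k) ⟩
    suc k + k                       ∎)
    where
    rearrange₁ : ∀ x y z → x + y + z ≡ x + z + y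
    rearrange₁ = solve-∀
    rearrange₂ : ∀ h a → suc (h + h) + 2 * a ≡ suc ((h + a) + (h + a))
    rearrange₂ = solve-∀
  core : (n ∸ k) * suc d ≤ d * suc k
  core = +-cancelʳ-≤ (suc k) _ _ (begin
    (n ∸ k) * suc d + suc k               ≤⟨ +-monoʳ-≤ _ (≤-trans k<n n≤2ca) ⟩
    (n ∸ k) * suc d + 2 * (suc d * a)     ≡⟨ factor (n ∸ k) d a ⟩
    suc d * (n ∸ k + 2 * a)               ≤⟨ *-monoʳ-≤ (suc d) gap ⟩
    suc d * suc k                         ≡⟨ +-comm (suc k) (d * suc k) ⟩
    d * suc k + suc k                     ∎)
    where
    factor : ∀ e d a → e * suc d + 2 * (suc d * a) ≡ suc d * (e + 2 * a)
    factor = solve-∀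

module Window {n : ℕ} (Q d a : ℕ)
  (n≤2ca : n ≤ 2 * (suc d * a)) (a-large : 4 * Q * (suc d * suc d) ≤ a) (4a≤n : 4 * a ≤ n) where

  M t : ℕ
  M = n choose (n / 2)
  t = n / 2 + a + a

  t≤n : t ≤ n
  t≤n = *-cancelˡ-≤ 2 (begin
    2 * (n / 2 + a + a)       ≡⟨ expand (n / 2) a ⟩
    (n / 2 + n / 2) + 4 * a   ≤⟨ +-mono-≤ (2[n/2]≤n n) 4a≤n ⟩
    n + n                     ≡⟨ cong (n +_) (+-identityʳ n) ⟨
    2 * n                     ∎)
    where
    open ≤-Reasoning
    expand : ∀ h a → 2 * (h + a + a) ≡ (h + h) + 4 * a
    expand = solve-∀

  -- The first stretch of length `a` above the middle brings the ratio of binomials down to d/c;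
  -- over the second they shrink to a fraction c/(c + a). With the factor c of the geometric series
  -- the tail is at most c²M/(c + a), and `a-large` makes this at most M/(4Q).
  tail-small : {L : List (Subset n)} → Unique L → 4 * Q * upperTail L t ≤ M
  tail-small {L} uniq = *-cancelˡ-≤ (c * c) (begin
    c * c * (4 * Q * U)                  ≡⟨ regroup (c * c) (4 * Q) U ⟩
    U * (4 * Q * (c * c))                ≤⟨ *-monoʳ-≤ U (≤-trans a-large (m≤n+m a c)) ⟩
    U * (c + a)                          ≤⟨ *-monoˡ-≤ (c + a) bound ⟩
    c * n choose t * (c + a)             ≡⟨ *-assoc c (n choose t) (c + a) ⟩
    c * (n choose t * (c + a))           ≤⟨ *-monoʳ-≤ c (C-decay d (n / 2 + a) ratio a) ⟩
    c * (c * n choose (n / 2 + a))       ≤⟨ *-monoʳ-≤ c (*-monoʳ-≤ c (C-upper≤central n a)) ⟩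
    c * (c * M)                          ≡⟨ *-assoc c c M ⟨
    c * c * M                            ∎)
    where
    open ≤-Reasoning
    c U : ℕ
    c = suc d
    U = upperTail L t
    ratio = C-ratio d a n≤2ca
    bound : U ≤ c * n choose t
    bound = upperTail-bound d (n / 2 + a) uniq ratio (suc n ∸ t) t (m≤m+n _ a) (m+[n∸m]≡n (m≤n⇒m≤1+n t≤n))
    regroup : ∀ x y z → x * (y * z) ≡ z * (y * x)
    regroup = solve-∀

  inWindow? : (A : Subset n) → Dec (∣ A ∣ < t × n ∸ ∣ A ∣ < t)
  inWindow? A = (∣ A ∣ <? t) ×-dec (n ∸ ∣ A ∣ <? t)

  window : List (Subset n) → List (Subset n)
  window = filter inWindow?

  -- Complementation turns sets that are too small into sets that are too large, so one tail
  -- estimate serves both ends.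
  length≤window+tails : (L : List (Subset n)) → length L ≤ length (window L) + (upperTail L t + upperTail (map ∁ L) t)
  length≤window+tails L = begin
    length L
      ≡⟨ trans (∑-const L 1) (*-identityʳ _) ⟨
    ∑ L (λ _ → 1)
      ≤⟨ ∑-mono L (λ {A} _ → cover A) ⟩
    ∑ L (λ A → within A + beyond A)
      ≡⟨ trans (∑-+ L within beyond) (cong (∑ L within +_) (∑-+ L above below)) ⟩
    ∑ L within + (∑ L above + ∑ L below)
      ≡⟨ cong (λ z → ∑ L within + (∑ L above + z)) (∑-map ∁ L above) ⟨
    ∑ L within + (∑ L above + ∑ (map ∁ L) above)
      ≡⟨ cong₂ _+_ (length-filter≡∑ inWindow? L)
           (cong₂ _+_ (length-filter≡∑ (λ A → t ≤? ∣ A ∣) L) (length-filter≡∑ (λ A → t ≤? ∣ A ∣) (map ∁ L))) ⟨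
    length (window L) + (upperTail L t + upperTail (map ∁ L) t) ∎
    where
    open ≤-Reasoning
    within above below beyond : Subset n → ℕ
    within  A = ⟦ inWindow? A ⟧
    above   A = ⟦ t ≤? ∣ A ∣ ⟧
    below   A = ⟦ t ≤? ∣ ∁ A ∣ ⟧
    beyond  A = above A + below A
    cover : ∀ A → 1 ≤ ⟦ inWindow? A ⟧ + (⟦ t ≤? ∣ A ∣ ⟧ + ⟦ t ≤? ∣ ∁ A ∣ ⟧)
    cover A with t ≤? ∣ A ∣ | t ≤? ∣ ∁ A ∣
    ... | yes p | _     = ≤-trans (1≤⟦⟧ (t ≤? ∣ A ∣) p) (≤-trans (m≤m+n (above A) (below A)) (m≤n+m (beyond A) (within A)))
    ... | no p  | yes q = ≤-trans (1≤⟦⟧ (t ≤? ∣ ∁ A ∣) q) (≤-trans (m≤n+m (below A) (above A)) (m≤n+m (beyond A) (within A)))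
    ... | no p  | no q  = ≤-trans (1≤⟦⟧ (inWindow? A) (≰⇒> p , subst (_< t) (∣∁p∣≡n∸∣p∣ A) (≰⇒> q))) (m≤m+n _ _)

  -- Each tail costs at most M/(4Q), so an excess of 1/Q over the central binomial drops to 1/(2Q).
  window-large : {L : List (Subset n)} → Unique L → suc Q * M ≤ Q * length L →
                 suc (2 * Q) * M ≤ 2 * Q * length (window L)
  window-large {L} uniq large = +-cancelʳ-≤ M _ _ (*-cancelˡ-≤ 2 (begin
    2 * (suc (2 * Q) * M + M)             ≡⟨ expand₁ Q M ⟩
    4 * (suc Q * M)                       ≤⟨ *-monoʳ-≤ 4 large ⟩
    4 * (Q * length L)                    ≤⟨ *-monoʳ-≤ 4 (*-monoʳ-≤ Q (length≤window+tails L)) ⟩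
    4 * (Q * (W + (U + U′)))              ≡⟨ expand₂ Q W U U′ ⟩
    4 * Q * W + (4 * Q * U + 4 * Q * U′)  ≤⟨ +-monoʳ-≤ (4 * Q * W) (+-mono-≤ (tail-small uniq) (tail-small (Unique.map⁺ ∁-injective uniq))) ⟩
    4 * Q * W + (M + M)                   ≡⟨ expand₃ Q W M ⟩
    2 * (2 * Q * W + M)                   ∎))
    where
    open ≤-Reasoning
    W U U′ : ℕ
    W  = length (window L)
    U  = upperTail L t
    U′ = upperTail (map ∁ L) t
    expand₁ : ∀ Q M → 2 * (suc (2 * Q) * M + M) ≡ 4 * (suc Q * M)
    expand₁ = solve-∀
    expand₂ : ∀ Q W U U′ → 4 * (Q * (W + (U + U′))) ≡ 4 * Q * W + (4 * Q * U + 4 * Q * U′)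
    expand₂ = solve-∀
    expand₃ : ∀ Q W M → 4 * Q * W + (M + M) ≡ 2 * (2 * Q * W + M)
    expand₃ = solve-∀

-- Blocks and the head link graph

-- If every member were hit with probability below 1/(4Q), then `lym` would give (1 - 1/(4Q))·|L| ≤
-- M, whereas (1 + 1/(2Q))(1 - 1/(4Q)) > 1.
frequentlyHit : ∀ {L : List (Subset n)} {Q} → 1 ≤ Q → Unique L →
                suc (2 * Q) * n choose (n / 2) ≤ 2 * Q * length L →
                ∃ λ C → C L.∈ L × ∣ C ∣ ! ≤ 4 * Q * hitCount L C
frequentlyHit {n} {L} {suc q} (s≤s _) uniq large with any? (λ C → ∣ C ∣ ! ≤? 4 * suc q * hitCount L C) L
... | yes found = L.find found
... | no  none  = contradiction absurd (<⇒≱ exceeds)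
  where
  open ≤-Reasoning
  Q M N e : ℕ
  Q = suc q
  M = n choose (n / 2)
  N = length L
  e = 3 + 4 * q
  4Q≡ : 4 * Q ≡ suc e
  4Q≡ = identity q
    where
    identity : ∀ q → 4 * suc q ≡ suc (3 + 4 * q)
    identity = solve-∀
  mostlyMiss : ∀ {A} → A L.∈ L → e * ∣ A ∣ ! ≤ 4 * Q * missCount L A
  mostlyMiss {A} A∈L = +-cancelˡ-≤ (∣ A ∣ !) _ _ (begin
    ∣ A ∣ ! + e * ∣ A ∣ !
      ≡⟨ cong (_* ∣ A ∣ !) 4Q≡ ⟨
    4 * Q * ∣ A ∣ !
      ≡⟨ cong (4 * Q *_) (hit+miss≡! L A) ⟨
    4 * Q * (hitCount L A + missCount L A)
      ≡⟨ *-distribˡ-+ (4 * Q) (hitCount L A) (missCount L A) ⟩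
    4 * Q * hitCount L A + 4 * Q * missCount L A
      ≤⟨ +-monoˡ-≤ _ (<⇒≤ (≰⇒> λ frequent → none (L.lose A∈L frequent))) ⟩
    ∣ A ∣ ! + 4 * Q * missCount L A ∎)
  eN≤4QM : e * N ≤ 4 * Q * M
  eN≤4QM = *-cancelʳ-≤ _ _ (n !) {{n !≢0}} (begin
    e * N * n !
      ≡⟨ trans (*-assoc e N (n !)) (cong (e *_) (sym (∑-const L (n !)))) ⟩
    e * ∑ L (λ _ → n !)
      ≡⟨ ∑-*ˡ L e _ ⟨
    ∑ L (λ _ → e * n !)
      ≤⟨ ∑-mono L (λ {A} A∈L → term A∈L) ⟩
    ∑ L (λ A → 4 * Q * M * ((n ∸ ∣ A ∣) ! * missCount L A))
      ≡⟨ ∑-*ˡ L (4 * Q * M) _ ⟩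
    4 * Q * M * ∑ L (λ A → (n ∸ ∣ A ∣) ! * missCount L A)
      ≤⟨ *-monoʳ-≤ (4 * Q * M) (lym uniq) ⟩
    4 * Q * M * n ! ∎)
    where
    term : ∀ {A} → A L.∈ L → e * n ! ≤ 4 * Q * M * ((n ∸ ∣ A ∣) ! * missCount L A)
    term {A} A∈L = begin
      e * n !
        ≤⟨ *-monoʳ-≤ e (n!≤central*!*! A) ⟩
      e * (M * (∣ A ∣ ! * (n ∸ ∣ A ∣) !))
        ≡⟨ regroup₁ e M (∣ A ∣ !) ((n ∸ ∣ A ∣) !) ⟩
      M * (n ∸ ∣ A ∣) ! * (e * ∣ A ∣ !)
        ≤⟨ *-monoʳ-≤ (M * (n ∸ ∣ A ∣) !) (mostlyMiss A∈L) ⟩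
      M * (n ∸ ∣ A ∣) ! * (4 * Q * missCount L A)
        ≡⟨ regroup₂ M ((n ∸ ∣ A ∣) !) (4 * Q) (missCount L A) ⟩
      4 * Q * M * ((n ∸ ∣ A ∣) ! * missCount L A) ∎
      where
      regroup₁ : ∀ e M x y → e * (M * (x * y)) ≡ M * y * (e * x)
      regroup₁ = solve-∀
      regroup₂ : ∀ M y f z → M * y * (f * z) ≡ f * M * (y * z)
      regroup₂ = solve-∀
  absurd : e * (suc (2 * Q) * M) ≤ 2 * Q * (4 * Q * M)
  absurd = begin
    e * (suc (2 * Q) * M) ≤⟨ *-monoʳ-≤ e large ⟩
    e * (2 * Q * N)       ≡⟨ regroup e (2 * Q) N ⟩
    2 * Q * (e * N)       ≤⟨ *-monoʳ-≤ (2 * Q) eN≤4QM ⟩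
    2 * Q * (4 * Q * M)   ∎
    where
    regroup : ∀ x y z → x * (y * z) ≡ y * (x * z)
    regroup = solve-∀
  -- Here `e` is 4Q - 1, and (4Q - 1)(2Q + 1) = 8Q² + (2Q - 1) with 2Q - 1 = 1 + 2q > 0.
  exceeds : 2 * Q * (4 * Q * M) < e * (suc (2 * Q) * M)
  exceeds = begin-strict
    2 * Q * (4 * Q * M)                          <⟨ m<m+n _ (≤-trans (central>0 n) (m≤m+n M (2 * q * M))) ⟩
    2 * Q * (4 * Q * M) + (M + 2 * q * M)        ≡⟨ expand q M ⟩
    e * (suc (2 * Q) * M)                        ∎
    where
    expand : ∀ q M → 2 * suc q * (4 * suc q * M) + (M + 2 * q * M) ≡ (3 + 4 * q) * (suc (2 * suc q) * M)
    expand = solve-∀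

take-++ : ∀ i (xs ys : List X) → i ≤ length xs → take i (xs ++ ys) ≡ take i xs
take-++ zero    xs       ys _         = refl
take-++ (suc i) (x ∷ xs) ys (s≤s i≤) = cong (x ∷_) (take-++ i xs ys i≤)

∣p∪q∣+∣p∩q∣≡∣p∣+∣q∣ : (p q : Subset n) → ∣ p ∪ q ∣ + ∣ p ∩ q ∣ ≡ ∣ p ∣ + ∣ q ∣
∣p∪q∣+∣p∩q∣≡∣p∣+∣q∣ []            []            = refl
∣p∪q∣+∣p∩q∣≡∣p∣+∣q∣ (inside ∷ p)  (inside ∷ q)  =
  cong suc (trans (+-suc _ _) (trans (cong suc (∣p∪q∣+∣p∩q∣≡∣p∣+∣q∣ p q)) (sym (+-suc _ _))))
∣p∪q∣+∣p∩q∣≡∣p∣+∣q∣ (inside ∷ p)  (outside ∷ q) = cong suc (∣p∪q∣+∣p∩q∣≡∣p∣+∣q∣ p q)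
∣p∪q∣+∣p∩q∣≡∣p∣+∣q∣ (outside ∷ p) (inside ∷ q)  = trans (cong suc (∣p∪q∣+∣p∩q∣≡∣p∣+∣q∣ p q)) (sym (+-suc _ _))
∣p∪q∣+∣p∩q∣≡∣p∣+∣q∣ (outside ∷ p) (outside ∷ q) = ∣p∪q∣+∣p∩q∣≡∣p∣+∣q∣ p q

-- Equivalently, the binomial coefficient of x + y over x is at least x + y when x = a + 1 and y = b
-- + 1 are positive. Each application saves one factor of order n in the counts below.
!*!≤! : ∀ a b → suc a ! * suc b ! ≤ suc (a + b) !
!*!≤! zero    b = ≤-reflexive (+-identityʳ (suc b !))
!*!≤! (suc a) b = begin
  suc (suc a) * suc a ! * suc b !       ≡⟨ *-assoc (suc (suc a)) (suc a !) (suc b !) ⟩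
  suc (suc a) * (suc a ! * suc b !)     ≤⟨ *-mono-≤ (s≤s (s≤s (m≤m+n a b))) (!*!≤! a b) ⟩
  suc (suc (a + b)) * suc (a + b) !     ∎
  where open ≤-Reasoning

-- A maximal subgraph of bounded degree

sameEdge? : (e e′ : Edge n) → Dec (SameEdge e e′)
sameEdge? (A , B) (A′ , B′) = ((A ≟ₛ A′) ×-dec (B ≟ₛ B′)) ⊎-dec ((A ≟ₛ B′) ×-dec (B ≟ₛ A′))

module Greedy {n : ℕ} (s : ℕ) where

  Addable : List (Edge n) → Edge n → Set
  Addable E (A , B) = ¬ Any (SameEdge (A , B)) E × degree E A < s × degree E B < s

  addable? : ∀ E e → Dec (Addable E e)
  addable? E (A , B) = ¬? (any? (sameEdge? (A , B)) E) ×-dec ((degree E A <? s) ×-dec (degree E B <? s))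

  greedy : List (Edge n) → List (Edge n)
  greedy []       = []
  greedy (e ∷ es) with addable? (greedy es) e
  ... | yes _ = e ∷ greedy es
  ... | no _  = greedy es

  greedy-All : {P : Edge n → Set} (es : List (Edge n)) → All P es → All P (greedy es)
  greedy-All []       []         = []
  greedy-All (e ∷ es) (pe ∷ pes) with addable? (greedy es) e
  ... | yes _ = pe ∷ greedy-All es pes
  ... | no _  = greedy-All es pes

  greedy-distinct : ∀ es → AllPairs (λ e e′ → ¬ SameEdge e e′) (greedy es)
  greedy-distinct []       = []
  greedy-distinct (e ∷ es) with addable? (greedy es) e
  ... | yes (new , _) = All.¬Any⇒All¬ (greedy es) new ∷ greedy-distinct es
  ... | no _          = greedy-distinct es

  greedy-degree : ∀ es X → degree (greedy es) X ≤ s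
  greedy-degree []             X = z≤n
  greedy-degree ((A , B) ∷ es) X with addable? (greedy es) (A , B)
  ... | no _                   = greedy-degree es X
  ... | yes (_ , degA , degB) with incident? X (A , B)
  ...   | no ¬inc          rewrite List.filter-reject (incident? X) {xs = greedy es} ¬inc = greedy-degree es X
  ...   | yes (inj₁ refl)  rewrite List.filter-accept (incident? X) {x = A , B} {xs = greedy es} (inj₁ refl) = degA
  ...   | yes (inj₂ refl)  rewrite List.filter-accept (incident? X) {x = A , B} {xs = greedy es} (inj₂ refl) = degB

  degree-∷ : ∀ (e : Edge n) E X → degree E X ≤ degree (e ∷ E) X
  degree-∷ e E X with incident? X e
  ... | yes inc rewrite List.filter-accept (incident? X) {xs = E} inc = n≤1+n _
  ... | no ¬inc rewrite List.filter-reject (incident? X) {xs = E} ¬inc = ≤-refl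

  -- Maximality in a form that survives the addition of edges: the reason for which an edge was
  -- rejected stays valid for the final subgraph.
  Covered : List (Edge n) → Edge n → Set
  Covered E (A , B) = Any (SameEdge (A , B)) E ⊎ (s ≤ degree E A ⊎ s ≤ degree E B)

  covered-∷ : ∀ e {E} e′ → Covered E e′ → Covered (e ∷ E) e′
  covered-∷ e     (A , B) (inj₁ same)         = inj₁ (there same)
  covered-∷ e {E} (A , B) (inj₂ (inj₁ full))  = inj₂ (inj₁ (≤-trans full (degree-∷ e E A)))
  covered-∷ e {E} (A , B) (inj₂ (inj₂ full))  = inj₂ (inj₂ (≤-trans full (degree-∷ e E B)))

  ¬addable⇒covered : ∀ E e → ¬ Addable E e → Covered E e
  ¬addable⇒covered E (A , B) ¬add with any? (sameEdge? (A , B)) E | degree E A <? s | degree E B <? s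
  ... | yes same | _        | _        = inj₁ same
  ... | no _     | no full  | _        = inj₂ (inj₁ (≮⇒≥ full))
  ... | no _     | yes _    | no full  = inj₂ (inj₂ (≮⇒≥ full))
  ... | no new   | yes degA | yes degB = contradiction (new , degA , degB) ¬add

  greedy-covers : ∀ es {e} → e L.∈ es → Covered (greedy es) e
  greedy-covers (e ∷ es) (here refl) with addable? (greedy es) e
  ... | yes _   = inj₁ (here (inj₁ (refl , refl)))
  ... | no ¬add = ¬addable⇒covered (greedy es) e ¬add
  greedy-covers (e ∷ es) {e′} (there e′∈) with addable? (greedy es) e
  ... | yes _   = covered-∷ e e′ (greedy-covers es e′∈)
  ... | no _    = greedy-covers es e′∈

∑degree≤2∣E∣ : {V : List (Subset n)} (E : List (Edge n)) → Unique V → ∑ V (degree E) ≤ 2 * length E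
∑degree≤2∣E∣ {V = V} E uniq = begin
  ∑ V (degree E)                                   ≡⟨ ∑-cong V (λ X → length-filter≡∑ (incident? X) E) ⟩
  ∑ V (λ X → ∑ E (λ e → ⟦ incident? X e ⟧))        ≡⟨ ∑-swap V E _ ⟩
  ∑ E (λ e → ∑ V (λ X → ⟦ incident? X e ⟧))        ≤⟨ ∑-mono E (λ {e} _ → endpoints e) ⟩
  ∑ E (λ _ → 2)                                    ≡⟨ trans (∑-const E 2) (*-comm (length E) 2) ⟩
  2 * length E                                     ∎
  where
  open ≤-Reasoning
  endpoints : ∀ e → ∑ V (λ X → ⟦ incident? X e ⟧) ≤ 2
  endpoints (A , B) = begin
    ∑ V (λ X → ⟦ (A ≟ₛ X) ⊎-dec (B ≟ₛ X) ⟧)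
      ≤⟨ ∑-mono V (λ {X} _ → ⟦⟧≤ ((A ≟ₛ X) ⊎-dec (B ≟ₛ X)) λ where
           (inj₁ p) → ≤-trans (1≤⟦⟧ (A ≟ₛ X) p) (m≤m+n _ _)
           (inj₂ q) → ≤-trans (1≤⟦⟧ (B ≟ₛ X) q) (m≤n+m _ _)) ⟩
    ∑ V (λ X → ⟦ A ≟ₛ X ⟧ + ⟦ B ≟ₛ X ⟧)
      ≡⟨ ∑-+ V _ _ ⟩
    ∑ V (λ X → ⟦ A ≟ₛ X ⟧) + ∑ V (λ X → ⟦ B ≟ₛ X ⟧)
      ≤⟨ +-mono-≤ (∑⟦⟧≤1 (A ≟ₛ_) uniq (λ _ _ p q → trans (sym p) q)) (∑⟦⟧≤1 (B ≟ₛ_) uniq (λ _ _ p q → trans (sym p) q)) ⟩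
    2 ∎

-- A number k of indices with value 1 satisfies k ≤ 1 + k(k - 1)/2. This turns a lower bound on the
-- expected number of hit blocks into one on pairs of hit blocks.
count≤1+pairs : (u : ℕ → ℕ) → (∀ j → u j ≤ 1) → ∀ r →
                ∑ (downFrom r) u ≤ 1 + ∑ (downFrom r) (λ j → ∑ (downFrom j) (λ i → u i * u j))
count≤1+pairs u u≤1 zero    = z≤n
count≤1+pairs u u≤1 (suc r) = begin
  u r + U           ≤⟨ step (u r) (u≤1 r) ⟩
  1 + (U * u r + R) ≡⟨ cong (λ z → 1 + (z + R)) (∑-*ʳ (downFrom r) (u r) u) ⟨
  1 + (∑ (downFrom r) (λ i → u i * u r) + R) ∎
  where
  open ≤-Reasoning
  U R : ℕ
  U = ∑ (downFrom r) u
  R = ∑ (downFrom r) (λ j → ∑ (downFrom j) (λ i → u i * u j))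
  step : ∀ v → v ≤ 1 → v + U ≤ 1 + (U * v + R)
  step zero    _       = ≤-trans (count≤1+pairs u u≤1 r) (s≤s (m≤n+m R (U * 0)))
  step (suc zero) _    = s≤s (≤-trans (≤-reflexive (sym (*-identityʳ U))) (m≤m+n (U * 1) R))
  step (suc (suc _)) (s≤s ())

-- Orderings that pass through one or two given sets

module Counting {n : ℕ} (C : Subset n) (K : ℕ) (2K<m : K + K < ∣ C ∣) where

  m : ℕ
  m = ∣ C ∣

  reach : Subset n → List (Fin n) → ℕ
  reach A xs = ⟦ reaches? C A xs ⟧

  reach-dependsOnFirst : ∀ {A} → m ∸ ∣ A ∣ ≤ K → DependsOnFirst K (reach A)
  reach-dependsOnFirst {A} i≤K xs ys K≤ =
    cong (λ zs → ⟦ (C ⊖ zs) ≟ₛ A ⟧) (take-++ (m ∸ ∣ A ∣) xs ys (≤-trans i≤K K≤))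

  reaches⇒⊆ : ∀ {A} xs → Reaches C A xs → A ⊆ C
  reaches⇒⊆ {A} xs eq x∈A = ⊖-⊆ C (take (m ∸ ∣ A ∣) xs) (subst (_ ∈_) (sym eq) x∈A)

  codim≥1 : ∀ {A} → A ⊆ C → A ≢ C → 1 ≤ m ∸ ∣ A ∣
  codim≥1 {A} A⊆C A≢C = m<n⇒0<n∸m (≤∧≢⇒< (p⊆q⇒∣p∣≤∣q∣ A⊆C) (A≢C ∘ p⊆q∧∣p∣≡∣q∣⇒p≡q A⊆C))

  codim+size : ∀ {A} → A ⊆ C → m ∸ ∣ A ∣ + ∣ A ∣ ≡ m
  codim+size A⊆C = m∸n+n≡m (p⊆q⇒∣p∣≤∣q∣ A⊆C)

  size≥1 : ∀ {A} → A ⊆ C → m ∸ ∣ A ∣ ≤ K → 1 ≤ ∣ A ∣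
  size≥1 {A} A⊆C i≤K = +-cancelˡ-≤ (m ∸ ∣ A ∣) _ _ (begin
    m ∸ ∣ A ∣ + 1     ≡⟨ +-comm _ 1 ⟩
    suc (m ∸ ∣ A ∣)   ≤⟨ s≤s (≤-trans i≤K (m≤m+n K K)) ⟩
    suc (K + K)       ≤⟨ 2K<m ⟩
    m                 ≡⟨ codim+size A⊆C ⟨
    m ∸ ∣ A ∣ + ∣ A ∣ ∎)
    where open ≤-Reasoning

  !*!≤!∸1 : ∀ {a b} → 1 ≤ a → 1 ≤ b → a ! * b ! ≤ (a + b ∸ 1) !
  !*!≤!∸1 {suc a} {suc b} _ _ = ≤-trans (!*!≤! a b) (≤-reflexive (cong _! (sym (+-suc a b))))

  -- A set `A` below `C` is reached with probability one over the binomial coefficient of m over ∣ A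
  -- ∣. This is at most 1/m because `A` is neither `C` nor, by `2K<m`, empty.
  reach-count : ∀ {A} → A ≢ C → m ∸ ∣ A ∣ ≤ K → ∑ₒ m C (reach A) ≤ (m ∸ 1) !
  reach-count {A} A≢C i≤K with A ⊆? C
  ... | no A⊈C = ≤-trans (≤-reflexive (trans
          (∑ₒ-cong m C λ {xs} _ → ⟦⟧-no (reaches? C A xs) (A⊈C ∘ reaches⇒⊆ xs)) (∑ₒ-0 m C))) z≤n
  ... | yes A⊆C = begin
    ∑ₒ m C (reach A)
      ≡⟨ ∑ₒ-cong m C (λ {xs} _ → sym (*-identityʳ (reach A xs))) ⟩
    ∑ₒ m C (λ xs → reach A xs * 1)
      ≡⟨ cong (λ k → ∑ₒ k C (λ xs → reach A xs * 1)) (codim+size A⊆C) ⟨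
    ∑ₒ (m ∸ ∣ A ∣ + ∣ A ∣) C (λ xs → reach A xs * 1)
      ≡⟨ ∑ₒ-prefix (m ∸ ∣ A ∣) (∣ A ∣) (λ _ → 1) A⊆C (sym (codim+size A⊆C)) ⟩
    (m ∸ ∣ A ∣) ! * ∑ₒ (∣ A ∣) A (λ _ → 1)
      ≡⟨ cong ((m ∸ ∣ A ∣) ! *_) (∑ₒ-1 (∣ A ∣) A refl) ⟩
    (m ∸ ∣ A ∣) ! * ∣ A ∣ !
      ≤⟨ !*!≤!∸1 (codim≥1 A⊆C A≢C) (size≥1 A⊆C i≤K) ⟩
    (m ∸ ∣ A ∣ + ∣ A ∣ ∸ 1) !
      ≡⟨ cong (λ k → (k ∸ 1) !) (codim+size A⊆C) ⟩
    (m ∸ 1) ! ∎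
    where open ≤-Reasoning

  -- Split the ordering where it reaches `A`. Inside `A` the later block must lead to `A ∩ B`;
  -- rotated to the front it is counted by `∑ₒ-prefix`. The resulting product of three factorials of
  -- positive numbers with sum m is at most (m - 2)!.
  reach-pair-count : ∀ {A B} s → A ∪ B ≡ C → A ≢ C → B ≢ C → m ∸ ∣ A ∣ ≤ K → m ∸ ∣ B ∣ ≤ K →
                     K ≤ s → s + K ≤ m → ∑ₒ m C (λ xs → reach A xs * reach B (drop s xs)) ≤ (m ∸ 2) !
  reach-pair-count {A} {B} s A∪B≡C A≢C B≢C i≤K j≤K K≤s s+K≤m = begin
    ∑ₒ m C (λ xs → reach A xs * reach B (drop s xs))
      ≡⟨ ∑ₒ-cong m C (λ {xs} _ → cong (λ zs → reach A xs * reach B zs)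
           (trans (cong (λ k → drop k xs) (sym i+g≡s)) (sym (List.drop-drop i g xs)))) ⟩
    ∑ₒ m C product
      ≡⟨ cong (λ k → ∑ₒ k C product) (codim+size A⊆C) ⟨
    ∑ₒ (i + ∣ A ∣) C product
      ≡⟨ ∑ₒ-prefix i (∣ A ∣) (reach B ∘ drop g) A⊆C (sym (codim+size A⊆C)) ⟩
    i ! * ∑ₒ (∣ A ∣) A (reach B ∘ drop g)
      -- Intersecting the condition for `B` with `A` makes it a statement about orderings of `A`
      -- alone.
      ≤⟨ *-monoʳ-≤ (i !) (∑ₒ-mono (∣ A ∣) A λ {xs} _ → ⟦⟧-mono (reaches? C B (drop g xs)) ((A ⊖ take j (drop g xs)) ≟ₛ (A ∩ B))
           λ eq → trans (⊖-∩ A⊆C (take j (drop g xs))) (cong (A ∩_) eq)) ⟩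
    i ! * ∑ₒ (∣ A ∣) A (meet ∘ drop g)
      ≡⟨ cong (i ! *_) (∑ₒ-drop g {j} (∣ A ∣) A
           (λ xs ys j≤ → cong (λ zs → ⟦ (A ⊖ zs) ≟ₛ (A ∩ B) ⟧) (take-++ j xs ys j≤)) g+j≤∣A∣) ⟩
    i ! * ∑ₒ (∣ A ∣) A meet
      ≡⟨ cong (i ! *_) (∑ₒ-cong (∣ A ∣) A (λ {xs} _ → sym (*-identityʳ (meet xs)))) ⟩
    i ! * ∑ₒ (∣ A ∣) A (λ xs → meet xs * 1)
      ≡⟨ cong (λ k → i ! * ∑ₒ k A (λ xs → meet xs * 1)) ∣A∣≡ ⟩
    i ! * ∑ₒ (j + ∣ A ∩ B ∣) A (λ xs → meet xs * 1)
      ≡⟨ cong (i ! *_) (∑ₒ-prefix j (∣ A ∩ B ∣) (λ _ → 1) (p∩q⊆p A B) ∣A∣≡) ⟩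
    i ! * (j ! * ∑ₒ (∣ A ∩ B ∣) (A ∩ B) (λ _ → 1))
      ≡⟨ cong (λ z → i ! * (j ! * z)) (∑ₒ-1 (∣ A ∩ B ∣) (A ∩ B) refl) ⟩
    i ! * (j ! * ∣ A ∩ B ∣ !)
      ≤⟨ *-monoʳ-≤ (i !) (!*!≤!∸1 j≥1 ∣A∩B∣≥1) ⟩
    i ! * (j + ∣ A ∩ B ∣ ∸ 1) !
      ≡⟨ cong (λ k → i ! * (k ∸ 1) !) ∣A∣≡ ⟨
    i ! * (∣ A ∣ ∸ 1) !
      ≤⟨ !*!≤!∸1 (codim≥1 A⊆C A≢C) ∣A∣≥2 ⟩
    (i + (∣ A ∣ ∸ 1) ∸ 1) !
      ≡⟨ cong (λ k → (k ∸ 1) !) (trans (sym (+-∸-assoc i (size≥1 A⊆C i≤K))) (cong (_∸ 1) (codim+size A⊆C))) ⟩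
    (m ∸ 1 ∸ 1) !
      ≡⟨ cong _! (∸-+-assoc m 1 1) ⟩
    (m ∸ 2) ! ∎
    where
    open ≤-Reasoning
    i j g : ℕ
    i = m ∸ ∣ A ∣
    j = m ∸ ∣ B ∣
    g = s ∸ i
    product meet : List (Fin n) → ℕ
    product xs = reach A xs * reach B (drop g (drop i xs))
    meet xs = ⟦ (A ⊖ take j xs) ≟ₛ (A ∩ B) ⟧
    A⊆C : A ⊆ C
    A⊆C x∈A = subst (_ ∈_) A∪B≡C (p⊆p∪q B x∈A)
    B⊆C : B ⊆ C
    B⊆C x∈B = subst (_ ∈_) A∪B≡C (q⊆p∪q A B x∈B)
    i+g≡s : i + g ≡ s
    i+g≡s = m+[n∸m]≡n (≤-trans i≤K K≤s)
    j≥1 : 1 ≤ j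
    j≥1 = codim≥1 B⊆C B≢C
    ∣A∣≡ : ∣ A ∣ ≡ j + ∣ A ∩ B ∣
    ∣A∣≡ = +-cancelʳ-≡ (∣ B ∣) _ _ (begin-equality
      ∣ A ∣ + ∣ B ∣         ≡⟨ ∣p∪q∣+∣p∩q∣≡∣p∣+∣q∣ A B ⟨
      ∣ A ∪ B ∣ + ∣ A ∩ B ∣ ≡⟨ cong (λ D → ∣ D ∣ + ∣ A ∩ B ∣) A∪B≡C ⟩
      m + ∣ A ∩ B ∣         ≡⟨ cong (_+ ∣ A ∩ B ∣) (codim+size B⊆C) ⟨
      j + ∣ B ∣ + ∣ A ∩ B ∣ ≡⟨ +-assoc j _ _ ⟩
      j + (∣ B ∣ + ∣ A ∩ B ∣) ≡⟨ cong (j +_) (+-comm (∣ B ∣) (∣ A ∩ B ∣)) ⟩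
      j + (∣ A ∩ B ∣ + ∣ B ∣) ≡⟨ +-assoc j _ _ ⟨
      j + ∣ A ∩ B ∣ + ∣ B ∣ ∎)
    -- Two blocks of length at most `K` cannot exhaust `C`.
    ∣A∩B∣≥1 : 1 ≤ ∣ A ∩ B ∣
    ∣A∩B∣≥1 = +-cancelˡ-≤ (i + j) _ _ (begin
      i + j + 1           ≡⟨ +-comm (i + j) 1 ⟩
      suc (i + j)         ≤⟨ s≤s (+-mono-≤ i≤K j≤K) ⟩
      suc (K + K)         ≤⟨ 2K<m ⟩
      m                   ≡⟨ codim+size A⊆C ⟨
      i + ∣ A ∣           ≡⟨ cong (i +_) ∣A∣≡ ⟩
      i + (j + ∣ A ∩ B ∣) ≡⟨ +-assoc i j _ ⟨
      i + j + ∣ A ∩ B ∣   ∎)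
    ∣A∣≥2 : 1 ≤ ∣ A ∣ ∸ 1
    ∣A∣≥2 = m+n≤o⇒m≤o∸n 1 (≤-trans (+-mono-≤ j≥1 ∣A∩B∣≥1) (≤-reflexive (sym ∣A∣≡)))
    g+j≤∣A∣ : g + j ≤ ∣ A ∣
    g+j≤∣A∣ = +-cancelˡ-≤ i _ _ (begin
      i + (g + j) ≡⟨ +-assoc i g j ⟨
      i + g + j   ≡⟨ cong (_+ j) i+g≡s ⟩
      s + j       ≤⟨ +-monoʳ-≤ s j≤K ⟩
      s + K       ≤⟨ s+K≤m ⟩
      m           ≡⟨ codim+size A⊆C ⟨
      i + ∣ A ∣   ∎)

-- From hit blocks to edges of the head link graph

module Blocks {n : ℕ} {W : List (Subset n)} (uniq : Unique W) (C : Subset n) (K : ℕ)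
  (width : ∀ {A} → A L.∈ W → ∣ C ∣ ∸ ∣ A ∣ ≤ K) (2≤m : 2 ≤ ∣ C ∣) (2K<m : K + K < ∣ C ∣) where

  open Counting C K 2K<m
  open Greedy {n} n

  hit : List (Fin n) → ℕ
  hit xs = ⟦ hits? W C xs ⟧

  -- This is what the restriction to the middle layers buys: a hit is decided within one block, so
  -- that blocks can be rotated.
  hit-dependsOnFirst : DependsOnFirst K hit
  hit-dependsOnFirst xs ys K≤ = ⟦⟧-cong (hits? W C (xs ++ ys)) (hits? W C xs)
    (λ h → let (A , A∈W , A≢C , eq) = L.find h in L.lose A∈W (A≢C , trans (sym (same A∈W)) eq))
    (λ h → let (A , A∈W , A≢C , eq) = L.find h in L.lose A∈W (A≢C , trans (same A∈W) eq))
    where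
    same : ∀ {A} → A L.∈ W → C ⊖ take (m ∸ ∣ A ∣) (xs ++ ys) ≡ C ⊖ take (m ∸ ∣ A ∣) xs
    same A∈W = cong (C ⊖_) (take-++ _ xs ys (≤-trans (width A∈W) K≤))

  JoinsTo : Edge n → Set
  JoinsTo (A , B) = A ≢ B × A ≢ C × B ≢ C × A ∪ B ≡ C

  joinsTo? : ∀ e → Dec (JoinsTo e)
  joinsTo? (A , B) = ¬? (A ≟ₛ B) ×-dec (¬? (A ≟ₛ C) ×-dec (¬? (B ≟ₛ C) ×-dec ((A ∪ B) ≟ₛ C)))

  -- Every pair occurs here in both orders; the `SameEdge` test of `greedy` admits at most one of
  -- them.
  candidates E : List (Edge n)
  candidates = filter joinsTo? (cartesianProduct W W)
  E = greedy candidates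

  E-isHLEdge : All (IsHLEdge W C) E
  E-isHLEdge = greedy-All candidates (All.tabulate λ { {A , B} e∈ →
    let (e∈W² , joins) = ∈-filter⁻ joinsTo? {xs = cartesianProduct W W} e∈
        (A∈W , B∈W) = ∈-cartesianProduct⁻ W W e∈W²
    in A∈W , B∈W , joins })

  -- `A ≢ C` is recorded for the sake of `reach-count`, whose bound fails for `C` itself.
  saturated? : (A : Subset n) → Dec (A ≢ C × n ≤ degree E A)
  saturated? A = ¬? (A ≟ₛ C) ×-dec (n ≤? degree E A)

  S : List (Subset n)
  S = filter saturated? W

  n*∣S∣≤2∣E∣ : n * length S ≤ 2 * length E
  n*∣S∣≤2∣E∣ = begin
    n * length S     ≡⟨ trans (*-comm n _) (sym (∑-const S n)) ⟩
    ∑ S (λ _ → n)    ≤⟨ ∑-mono S (λ A∈S → proj₂ (proj₂ (∈-filter⁻ saturated? {xs = W} A∈S))) ⟩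
    ∑ S (degree E)   ≤⟨ ∑degree≤2∣E∣ E (Unique.filter⁺ saturated? uniq) ⟩
    2 * length E     ∎
    where open ≤-Reasoning

  -- An edge is stored in one order, but either end may be the one met in the first block.
  edgeTerm : ℕ → Edge n → List (Fin n) → ℕ
  edgeTerm s (A , B) xs = reach A xs * reach B (drop s xs) + reach B xs * reach A (drop s xs)

  saturatedTerm : ℕ → Subset n → List (Fin n) → ℕ
  saturatedTerm s A xs = reach A xs + reach A (drop s xs)

  -- An element of `C` outside the block leading to `B` survives in `B`. One inside that block comes
  -- after the first `i` elements and is not repeated, so it survives in `A`.
  disjoint-blocks : ∀ {s xs A B} → Ordering m C xs → m ∸ ∣ A ∣ ≤ s →
                    Reaches C A xs → Reaches C B (drop s xs) → A ∪ B ≡ C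
  disjoint-blocks {s} {xs} {A} {B} o i≤s reachA reachB = ⊆-antisym
    (λ x∈ → case x∈p∪q⁻ A B x∈ of λ where
      (inj₁ x∈A) → reaches⇒⊆ xs reachA x∈A
      (inj₂ x∈B) → reaches⇒⊆ (drop s xs) reachB x∈B)
    λ {x} x∈C → x∈p∪q⁺ (case Any.any? (x Fin.≟_) block of λ where
      (no x∉)  → inj₂ (subst (x ∈_) reachB (∈-⊖⁺ block x∈C x∉))
      (yes x∈) → inj₁ (subst (x ∈_) reachA (Ordering-∈ (Ordering-drop i o)
        (drop-⊆ (s ∸ i) (drop i xs) (subst (x L.∈_) (sym split) (take-⊆ j (drop s xs) x∈))))))
    where
    i j : ℕ
    i = m ∸ ∣ A ∣
    j = m ∸ ∣ B ∣
    block : List (Fin n)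
    block = take j (drop s xs)
    split : drop (s ∸ i) (drop i xs) ≡ drop s xs
    split = trans (List.drop-drop i (s ∸ i) xs) (cong (λ k → drop k xs) (m+[n∸m]≡n i≤s))
    take-⊆ : ∀ k (ys : List (Fin n)) {x} → x L.∈ take k ys → x L.∈ ys
    take-⊆ (suc k) (y ∷ ys) (here p)  = here p
    take-⊆ (suc k) (y ∷ ys) (there p) = there (take-⊆ k ys p)
    drop-⊆ : ∀ k (ys : List (Fin n)) {x} → x L.∈ drop k ys → x L.∈ ys
    drop-⊆ zero    ys       p = p
    drop-⊆ (suc k) (y ∷ ys) p = there (drop-⊆ k ys p)

  -- Two hits produce a candidate edge. By maximality it is in `E` or has a saturated end, and
  -- either way some summand on the right is positive.
  pair-cover : ∀ {s xs} → K ≤ s → Ordering m C xs →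
               hit xs * hit (drop s xs) ≤ ∑ E (λ e → edgeTerm s e xs) + ∑ S (λ A → saturatedTerm s A xs)
  pair-cover {s} {xs} K≤s o =
    ≤-trans (≤-reflexive (sym (⟦⟧-× (hits? W C xs) (hits? W C (drop s xs)))))
      (⟦⟧≤ (hits? W C xs ×-dec hits? W C (drop s xs)) λ (hit₁ , hit₂) →
        let (A , A∈W , A≢C , reachA) = L.find hit₁
            (B , B∈W , B≢C , reachB) = L.find hit₂
        in cover A∈W B∈W A≢C B≢C reachA reachB)
    where
    edges saturated : ℕ
    edges     = ∑ E (λ e → edgeTerm s e xs)
    saturated = ∑ S (λ A → saturatedTerm s A xs)
    cover : ∀ {A B} → A L.∈ W → B L.∈ W → A ≢ C → B ≢ C →
            Reaches C A xs → Reaches C B (drop s xs) → 1 ≤ edges + saturated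
    cover {A} {B} A∈W B∈W A≢C B≢C reachA reachB = case greedy-covers candidates e∈ of λ where
        (inj₁ same) → let (e′ , e′∈E , eq) = L.find same in
          ≤-trans (1≤edgeTerm e′ eq) (≤-trans (∑-member (λ e → edgeTerm s e xs) e′∈E) (m≤m+n edges saturated))
        (inj₂ (inj₁ full)) → ≤-trans (≤-trans 1≤reachA (m≤m+n _ (reach A (drop s xs))))
          (1≤saturated (∈-filter⁺ saturated? A∈W (A≢C , full)))
        (inj₂ (inj₂ full)) → ≤-trans (≤-trans 1≤reachB (m≤n+m _ (reach B xs)))
          (1≤saturated (∈-filter⁺ saturated? B∈W (B≢C , full)))
      where
      1≤reachA : 1 ≤ reach A xs
      1≤reachA = 1≤⟦⟧ (reaches? C A xs) reachA
      1≤reachB : 1 ≤ reach B (drop s xs)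
      1≤reachB = 1≤⟦⟧ (reaches? C B (drop s xs)) reachB
      A∪B≡C : A ∪ B ≡ C
      A∪B≡C = disjoint-blocks o (≤-trans (width A∈W) K≤s) reachA reachB
      A≢B : A ≢ B
      A≢B refl = A≢C (trans (sym (∪-idem A)) A∪B≡C)
      e∈ : (A , B) L.∈ candidates
      e∈ = ∈-filter⁺ joinsTo? (∈-cartesianProduct⁺ A∈W B∈W) (A≢B , A≢C , B≢C , A∪B≡C)
      1≤edgeTerm : ∀ e′ → SameEdge (A , B) e′ → 1 ≤ edgeTerm s e′ xs
      1≤edgeTerm _ (inj₁ (refl , refl)) = ≤-trans (*-mono-≤ 1≤reachA 1≤reachB) (m≤m+n _ _)
      1≤edgeTerm _ (inj₂ (refl , refl)) = ≤-trans (*-mono-≤ 1≤reachA 1≤reachB) (m≤n+m _ (reach B xs * reach A (drop s xs)))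
      1≤saturated : ∀ {D} → D L.∈ S → saturatedTerm s D xs ≤ edges + saturated
      1≤saturated D∈S = ≤-trans (∑-member (λ D → saturatedTerm s D xs) D∈S) (m≤n+m saturated edges)

  pairBound : ℕ
  pairBound = length E * (2 * (m ∸ 2) !) + length S * (2 * (m ∸ 1) !)

  pair-count : ∀ s → K ≤ s → s + K ≤ m → ∑ₒ m C (λ xs → hit xs * hit (drop s xs)) ≤ pairBound
  pair-count s K≤s s+K≤m = begin
    ∑ₒ m C (λ xs → hit xs * hit (drop s xs))
      ≤⟨ ∑ₒ-mono m C (pair-cover K≤s) ⟩
    ∑ₒ m C (λ xs → ∑ E (λ e → edgeTerm s e xs) + ∑ S (λ A → saturatedTerm s A xs))
      ≡⟨ ∑ₒ-+ m C _ _ ⟩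
    ∑ₒ m C (λ xs → ∑ E (λ e → edgeTerm s e xs)) + ∑ₒ m C (λ xs → ∑ S (λ A → saturatedTerm s A xs))
      ≡⟨ cong₂ _+_ (∑ₒ-∑ m C E (edgeTerm s)) (∑ₒ-∑ m C S (saturatedTerm s)) ⟩
    ∑ E (λ e → ∑ₒ m C (edgeTerm s e)) + ∑ S (λ A → ∑ₒ m C (saturatedTerm s A))
      ≤⟨ +-mono-≤ (∑-mono E edge-count) (∑-mono S saturated-count) ⟩
    ∑ E (λ _ → 2 * (m ∸ 2) !) + ∑ S (λ _ → 2 * (m ∸ 1) !)
      ≡⟨ cong₂ _+_ (∑-const E _) (∑-const S _) ⟩
    pairBound ∎
    where
    open ≤-Reasoning
    z+z≡2*z : ∀ z → z + z ≡ 2 * z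
    z+z≡2*z z = cong (z +_) (sym (+-identityʳ z))
    edge-count : ∀ {e} → e L.∈ E → ∑ₒ m C (edgeTerm s e) ≤ 2 * (m ∸ 2) !
    edge-count {A , B} e∈E with A∈W , B∈W , _ , A≢C , B≢C , A∪B≡C ← All.lookup E-isHLEdge e∈E = begin
      ∑ₒ m C (edgeTerm s (A , B))
        ≡⟨ ∑ₒ-+ m C _ _ ⟩
      ∑ₒ m C (λ xs → reach A xs * reach B (drop s xs)) + ∑ₒ m C (λ xs → reach B xs * reach A (drop s xs))
        ≤⟨ +-mono-≤
             (reach-pair-count s A∪B≡C A≢C B≢C (width A∈W) (width B∈W) K≤s s+K≤m)
             (reach-pair-count s (trans (∪-comm B A) A∪B≡C) B≢C A≢C (width B∈W) (width A∈W) K≤s s+K≤m) ⟩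
      (m ∸ 2) ! + (m ∸ 2) !
        ≡⟨ z+z≡2*z ((m ∸ 2) !) ⟩
      2 * (m ∸ 2) ! ∎
    saturated-count : ∀ {A} → A L.∈ S → ∑ₒ m C (saturatedTerm s A) ≤ 2 * (m ∸ 1) !
    saturated-count {A} A∈S with A∈W , A≢C , _ ← ∈-filter⁻ saturated? {xs = W} A∈S = begin
      ∑ₒ m C (saturatedTerm s A)
        ≡⟨ ∑ₒ-+ m C _ _ ⟩
      ∑ₒ m C (reach A) + ∑ₒ m C (reach A ∘ drop s)
        ≡⟨ cong (∑ₒ m C (reach A) +_) (∑ₒ-drop s m C (reach-dependsOnFirst {A} (width A∈W)) s+K≤m) ⟩
      ∑ₒ m C (reach A) + ∑ₒ m C (reach A)
        ≤⟨ +-mono-≤ (reach-count A≢C (width A∈W)) (reach-count A≢C (width A∈W)) ⟩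
      (m ∸ 1) ! + (m ∸ 1) !
        ≡⟨ z+z≡2*z ((m ∸ 1) !) ⟩
      2 * (m ∸ 1) ! ∎

  block : List (Fin n) → ℕ → ℕ
  block xs j = hit (drop (j * K) xs)

  -- Rotation by `i * K` brings the earlier block to the front and keeps the distance between the
  -- two.
  blocks-count : ∀ {i j r} → i < j → j < r → r * K ≤ m → ∑ₒ m C (λ xs → block xs i * block xs j) ≤ pairBound
  blocks-count {i} {j} {r} i<j j<r rK≤m = begin
    ∑ₒ m C (λ xs → block xs i * block xs j)
      ≡⟨ ∑ₒ-cong m C (λ {xs} _ → cong (λ zs → block xs i * hit zs)
           (trans (cong (λ k → drop k xs) (sym iK+s≡jK)) (sym (List.drop-drop (i * K) s xs)))) ⟩
    ∑ₒ m C (both ∘ drop (i * K))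
      ≡⟨ ∑ₒ-drop (i * K) m C both-dependsOnFirst iK+s+K≤m ⟩
    ∑ₒ m C both
      ≤⟨ pair-count s K≤s (m+n≤o⇒n≤o (i * K) iK+s+K≤m) ⟩
    pairBound ∎
    where
    open ≤-Reasoning
    s : ℕ
    s = (j ∸ i) * K
    iK+s≡jK : i * K + s ≡ j * K
    iK+s≡jK = trans (sym (*-distribʳ-+ K i (j ∸ i))) (cong (_* K) (m+[n∸m]≡n (<⇒≤ i<j)))
    K≤s : K ≤ s
    K≤s = ≤-trans (≤-reflexive (sym (*-identityˡ K))) (*-monoˡ-≤ K (m<n⇒0<n∸m i<j))
    iK+s+K≤m : i * K + (s + K) ≤ m
    iK+s+K≤m = begin
      i * K + (s + K)  ≡⟨ +-assoc (i * K) s K ⟨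
      i * K + s + K    ≡⟨ cong (_+ K) iK+s≡jK ⟩
      j * K + K        ≡⟨ +-comm (j * K) K ⟩
      suc j * K        ≤⟨ *-monoˡ-≤ K j<r ⟩
      r * K            ≤⟨ rK≤m ⟩
      m                ∎
    both : List (Fin n) → ℕ
    both xs = hit xs * hit (drop s xs)
    both-dependsOnFirst : DependsOnFirst (s + K) both
    both-dependsOnFirst xs ys l≤ = cong₂ _*_
      (hit-dependsOnFirst xs ys (≤-trans (m≤n+m K s) l≤))
      (drop-dependsOnFirst s hit-dependsOnFirst xs ys l≤)

  -- By rotation the left side is the number of hit blocks summed over all orderings. The bound 1 +
  -- pairs contributes `m !` for the 1, and the number of pairs of blocks is estimated by r².
  blocks-bound : ∀ r → r * K ≤ m → r * hitCount W C ≤ m ! + r * (r * pairBound)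
  blocks-bound r rK≤m = begin
    r * hitCount W C
      ≡⟨ trans (∑-const R (hitCount W C)) (cong (_* hitCount W C) (List.length-downFrom r)) ⟨
    ∑ R (λ _ → hitCount W C)
      ≤⟨ ∑-mono R (λ j∈ → ≤-reflexive (sym (∑ₒ-drop _ m C hit-dependsOnFirst (room (∈-downFrom⁻ j∈))))) ⟩
    ∑ R (λ j → ∑ₒ m C (λ xs → block xs j))
      ≡⟨ ∑ₒ-∑ m C R (λ j xs → block xs j) ⟨
    ∑ₒ m C (λ xs → ∑ R (block xs))
      ≤⟨ ∑ₒ-mono m C (λ {xs} _ → count≤1+pairs (block xs) (λ j → ⟦⟧≤1 (hits? W C (drop (j * K) xs))) r) ⟩
    ∑ₒ m C (λ xs → 1 + ∑ R (λ j → ∑ (downFrom j) (λ i → block xs i * block xs j)))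
      ≡⟨ ∑ₒ-+ m C (λ _ → 1) _ ⟩
    ∑ₒ m C (λ _ → 1) + ∑ₒ m C (λ xs → ∑ R (λ j → ∑ (downFrom j) (λ i → block xs i * block xs j)))
      ≡⟨ cong₂ _+_ (∑ₒ-1 m C refl) (trans
           (∑ₒ-∑ m C R (λ j xs → ∑ (downFrom j) (λ i → block xs i * block xs j)))
           (∑-cong R λ j → ∑ₒ-∑ m C (downFrom j) (λ i xs → block xs i * block xs j))) ⟩
    m ! + ∑ R (λ j → ∑ (downFrom j) (λ i → ∑ₒ m C (λ xs → block xs i * block xs j)))
      ≤⟨ +-monoʳ-≤ (m !) (∑-mono R λ j∈ → ∑-mono (downFrom _) λ i∈ →
           blocks-count (∈-downFrom⁻ i∈) (∈-downFrom⁻ j∈) rK≤m) ⟩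
    m ! + ∑ R (λ j → ∑ (downFrom j) (λ _ → pairBound))
      ≤⟨ +-monoʳ-≤ (m !) (∑-mono R λ {j} j∈ → ≤-trans
           (≤-reflexive (trans (∑-const (downFrom j) pairBound) (cong (_* pairBound) (List.length-downFrom j))))
           (*-monoˡ-≤ pairBound (<⇒≤ (∈-downFrom⁻ j∈)))) ⟩
    m ! + ∑ R (λ _ → r * pairBound)
      ≡⟨ cong (m ! +_) (trans (∑-const R (r * pairBound)) (cong (_* (r * pairBound)) (List.length-downFrom r))) ⟩
    m ! + r * (r * pairBound) ∎
    where
    open ≤-Reasoning
    R : List ℕ
    R = downFrom r
    room : ∀ {j} → j < r → j * K + K ≤ m
    room {j} j<r = ≤-trans (≤-trans (≤-reflexive (+-comm (j * K) K)) (*-monoˡ-≤ K j<r)) rK≤m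

  -- The hypothesis says that two hit blocks are expected; cancelling the `m !` of `blocks-bound`
  -- leaves one for the pairs. The constant is 6 = 2·(1 + 2): `E` itself counts once and the
  -- saturated sets at most twice.
  many-edges : ∀ r → r * K ≤ m → 2 * m ! ≤ r * hitCount W C → m * (m ∸ 1) ≤ 6 * (r * r) * length E
  many-edges r rK≤m frequent = *-cancelʳ-≤ _ _ ((m ∸ 2) !) {{(m ∸ 2) !≢0}} (begin
    m * (m ∸ 1) * (m ∸ 2) !
      ≡⟨ trans (*-assoc m (m ∸ 1) _) (trans (cong (m *_) (sym [m-1]!)) (sym m!)) ⟩
    m !
      ≤⟨ +-cancelˡ-≤ (m !) _ _ (≤-trans (≤-reflexive (cong (m ! +_) (sym (+-identityʳ (m !)))))
           (≤-trans frequent (blocks-bound r rK≤m))) ⟩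
    r * (r * pairBound)
      ≡⟨ cong (λ z → r * (r * (length E * (2 * (m ∸ 2) !) + length S * (2 * z)))) [m-1]! ⟩
    r * (r * (length E * (2 * (m ∸ 2) !) + length S * (2 * ((m ∸ 1) * (m ∸ 2) !))))
      ≡⟨ factor r (length E) (length S) (m ∸ 1) ((m ∸ 2) !) ⟩
    2 * (r * r) * (length E + (m ∸ 1) * length S) * (m ∸ 2) !
      -- The degree cap takes effect here: (m - 1)·|S| ≤ n·|S| ≤ 2·|E|.
      ≤⟨ *-monoˡ-≤ ((m ∸ 2) !) (*-monoʳ-≤ (2 * (r * r)) (+-monoʳ-≤ (length E)
           (≤-trans (*-monoˡ-≤ (length S) (≤-trans (m∸n≤m m 1) (∣p∣≤n C))) n*∣S∣≤2∣E∣))) ⟩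
    2 * (r * r) * (length E + 2 * length E) * (m ∸ 2) !
      ≡⟨ cong (_* (m ∸ 2) !) (collect (r * r) (length E)) ⟩
    6 * (r * r) * length E * (m ∸ 2) ! ∎)
    where
    open ≤-Reasoning
    !-pred : ∀ k → 1 ≤ k → k ! ≡ k * (k ∸ 1) !
    !-pred (suc k) _ = refl
    m! : m ! ≡ m * (m ∸ 1) !
    m! = !-pred m (≤-trans (s≤s z≤n) 2K<m)
    [m-1]! : (m ∸ 1) ! ≡ (m ∸ 1) * (m ∸ 2) !
    [m-1]! = trans (!-pred (m ∸ 1) (m+n≤o⇒m≤o∸n 1 2≤m)) (cong (λ k → (m ∸ 1) * k !) (∸-+-assoc m 1 1))
    factor : ∀ r e s k f → r * (r * (e * (2 * f) + s * (2 * (k * f)))) ≡ 2 * (r * r) * (e + k * s) * f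
    factor = solve-∀
    collect : ∀ q e → 2 * q * (e + 2 * e) ≡ 6 * q * e
    collect = solve-∀

-- ε = 1/Q, with a ≈ n/(128Q): the layers kept lie within 2a of the middle, so chains between them have at
-- most K = 4a steps, and 8Q blocks of length K fit into any set of these layers.
module Core (q d : ℕ) (c≡128Q : suc d ≡ 128 * suc q) where

  Q c n₀ : ℕ
  Q = suc q
  c = suc d
  -- Chosen so that n/c reaches 4Qc², the size of `a` that makes the tails small.
  n₀ = 4 * Q * (c * c) * c

  module _ {n : ℕ} (n₀≤n : n₀ ≤ n) where

    open ≤-Reasoning

    a : ℕ
    a = n / c

    a-large : 4 * Q * (c * c) ≤ a
    a-large = ≤-trans (≤-reflexive (sym (m*n/n≡m (4 * Q * (c * c)) c))) (/-monoˡ-≤ c n₀≤n)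

    1≤a : 1 ≤ a
    1≤a = ≤-trans (s≤s z≤n) a-large

    ca≤n : c * a ≤ n
    ca≤n = ≤-trans (≤-reflexive (*-comm c a)) (m/n*n≤m n c)

    n≤2ca : n ≤ 2 * (c * a)
    n≤2ca = begin
      n                  ≡⟨ m≡m%n+[m/n]*n n c ⟩
      n % c + a * c      ≤⟨ +-monoˡ-≤ (a * c) (<⇒≤ (m%n<n n c)) ⟩
      c + a * c          ≡⟨ cong₂ _+_ (sym (*-identityʳ c)) (*-comm a c) ⟩
      c * 1 + c * a      ≤⟨ +-monoˡ-≤ (c * a) (*-monoʳ-≤ c 1≤a) ⟩
      c * a + c * a      ≡⟨ cong (c * a +_) (+-identityʳ (c * a)) ⟨
      2 * (c * a)        ∎

    4≤c : 4 ≤ c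
    4≤c = ≤-trans (*-mono-≤ {4} {128} {1} {Q} (m≤m+n 4 124) (s≤s z≤n)) (≤-reflexive (sym c≡128Q))

    4a≤n : 4 * a ≤ n
    4a≤n = ≤-trans (*-monoˡ-≤ a 4≤c) ca≤n

    open Window {n} Q d a n≤2ca a-large 4a≤n

    2t≤n+4a : t + t ≤ n + 4 * a
    2t≤n+4a = begin
      t + t                        ≡⟨ expand (n / 2) a ⟩
      (n / 2 + n / 2) + 4 * a      ≤⟨ +-monoˡ-≤ (4 * a) (2[n/2]≤n n) ⟩
      n + 4 * a                    ∎
      where
      expand : ∀ h a → (h + a + a) + (h + a + a) ≡ (h + h) + 4 * a
      expand = solve-∀

    Inside : Subset n → Set
    Inside A = ∣ A ∣ < t × n ∸ ∣ A ∣ < t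

    n≤t+size : ∀ A → Inside A → n ≤ t + ∣ A ∣
    n≤t+size A (_ , below) = begin
      n                     ≡⟨ m∸n+n≡m (∣p∣≤n A) ⟨
      n ∸ ∣ A ∣ + ∣ A ∣     ≤⟨ +-monoˡ-≤ (∣ A ∣) (<⇒≤ below) ⟩
      t + ∣ A ∣             ∎

    width : ∀ A C → Inside A → Inside C → ∣ C ∣ ∸ ∣ A ∣ ≤ 4 * a
    width A C inA (above , _) = m≤n+o⇒m∸n≤o (∣ C ∣) (∣ A ∣) (+-cancelˡ-≤ n _ _ (begin
      n + ∣ C ∣              ≤⟨ +-mono-≤ (n≤t+size A inA) (<⇒≤ above) ⟩
      t + ∣ A ∣ + t          ≡⟨ rearrange t (∣ A ∣) ⟩
      t + t + ∣ A ∣          ≤⟨ +-monoˡ-≤ (∣ A ∣) 2t≤n+4a ⟩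
      n + 4 * a + ∣ A ∣      ≡⟨ trans (+-assoc n (4 * a) (∣ A ∣)) (cong (λ z → n + z) (+-comm (4 * a) (∣ A ∣))) ⟩
      n + (∣ A ∣ + 4 * a)    ∎))
      where
      rearrange : ∀ x y → x + y + x ≡ x + x + y
      rearrange = solve-∀

    n≤4a+2size : ∀ C → Inside C → n ≤ 4 * a + 2 * ∣ C ∣
    n≤4a+2size C inC = +-cancelˡ-≤ n _ _ (begin
      n + n                           ≤⟨ +-mono-≤ (n≤t+size C inC) (n≤t+size C inC) ⟩
      (t + ∣ C ∣) + (t + ∣ C ∣)       ≡⟨ rearrange t (∣ C ∣) ⟩
      t + t + 2 * ∣ C ∣               ≤⟨ +-monoˡ-≤ (2 * ∣ C ∣) 2t≤n+4a ⟩
      n + 4 * a + 2 * ∣ C ∣           ≡⟨ +-assoc n (4 * a) (2 * ∣ C ∣) ⟩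
      n + (4 * a + 2 * ∣ C ∣)         ∎)
      where
      rearrange : ∀ x y → (x + y) + (x + y) ≡ x + x + 2 * y
      rearrange = solve-∀

    -- The room for 8Q blocks of length 4a: n ≥ 128Qa, and a set in the window has at least (n -
    -- 4a)/2 elements.
    32Qa≤size : ∀ C → Inside C → 8 * Q * (4 * a) ≤ ∣ C ∣
    32Qa≤size C inC = *-cancelˡ-≤ 2 (+-cancelˡ-≤ (4 * a) _ _ (begin
      4 * a + 2 * (8 * Q * (4 * a))                    ≤⟨ m≤m+n _ (60 * a + 64 * (q * a)) ⟩
      4 * a + 2 * (8 * Q * (4 * a)) + (60 * a + 64 * (q * a)) ≡⟨ expand q a ⟩
      128 * Q * a                                      ≡⟨ cong (_* a) c≡128Q ⟨
      c * a                                            ≤⟨ ca≤n ⟩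
      n                                                ≤⟨ n≤4a+2size C inC ⟩
      4 * a + 2 * ∣ C ∣                                ∎))
      where
      expand : ∀ q a → 4 * a + 2 * (8 * suc q * (4 * a)) + (60 * a + 64 * (q * a)) ≡ 128 * suc q * a
      expand = solve-∀

    32a≤size : ∀ C → Inside C → 32 * a ≤ ∣ C ∣
    32a≤size C inC = begin
      32 * a                       ≤⟨ m≤m+n _ (32 * (q * a)) ⟩
      32 * a + 32 * (q * a)        ≡⟨ expand q a ⟩
      8 * Q * (4 * a)              ≤⟨ 32Qa≤size C inC ⟩
      ∣ C ∣                        ∎
      where
      expand : ∀ q a → 32 * a + 32 * (q * a) ≡ 8 * suc q * (4 * a)
      expand = solve-∀

    2K<size : ∀ C → Inside C → 4 * a + 4 * a < ∣ C ∣
    2K<size C inC = begin-strict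
      4 * a + 4 * a                <⟨ m<m+n _ (≤-trans 1≤a (m≤m+n a (23 * a))) ⟩
      4 * a + 4 * a + 24 * a       ≡⟨ collect a ⟩
      32 * a                       ≤⟨ 32a≤size C inC ⟩
      ∣ C ∣                        ∎
      where
      collect : ∀ a → 4 * a + 4 * a + 24 * a ≡ 32 * a
      collect = solve-∀

    2≤size : ∀ C → Inside C → 2 ≤ ∣ C ∣
    2≤size C inC = ≤-trans (*-mono-≤ {2} {32} (s≤s (s≤s z≤n)) 1≤a) (32a≤size C inC)

    -- Comes from n ≤ 3m and m ≤ 2(m - 1), hence 18 = 3·3·2.
    n²≤18size : ∀ C → Inside C → n * n ≤ 18 * (∣ C ∣ * (∣ C ∣ ∸ 1))
    n²≤18size C inC = begin
      n * n                          ≤⟨ *-mono-≤ n≤3m n≤3m ⟩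
      3 * m * (3 * m)                ≤⟨ *-monoʳ-≤ (3 * m) (*-monoʳ-≤ 3 m≤2[m-1]) ⟩
      3 * m * (3 * (2 * (m ∸ 1)))    ≡⟨ collect m (m ∸ 1) ⟩
      18 * (m * (m ∸ 1))             ∎
      where
      m : ℕ
      m = ∣ C ∣
      n≤3m : n ≤ 3 * m
      n≤3m = begin
        n                ≤⟨ n≤4a+2size C inC ⟩
        4 * a + 2 * m    ≤⟨ +-monoˡ-≤ (2 * m) (≤-trans (*-monoˡ-≤ a (m≤m+n 4 28)) (32a≤size C inC)) ⟩
        m + 2 * m        ∎
      m≤2[m-1] : m ≤ 2 * (m ∸ 1)
      m≤2[m-1] = begin
        m                     ≡⟨ m+[n∸m]≡n (≤-trans (s≤s z≤n) (2≤size C inC)) ⟨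
        1 + (m ∸ 1)           ≤⟨ +-monoˡ-≤ (m ∸ 1) (m+n≤o⇒m≤o∸n 1 (2≤size C inC)) ⟩
        m ∸ 1 + (m ∸ 1)       ≡⟨ cong (m ∸ 1 +_) (+-identityʳ (m ∸ 1)) ⟨
        2 * (m ∸ 1)           ∎
      collect : ∀ x y → 3 * x * (3 * (2 * y)) ≡ 18 * (x * y)
      collect = solve-∀

    ManyEdges : List (Subset n) → Subset n → Set
    ManyEdges 𝓕 C = ∃ λ E → IsHLSubgraph 𝓕 C E × (∀ X → degree E X ≤ n)
      × n * n ≤ 18 * (6 * (8 * Q * (8 * Q)) * length E)

    core-at : ∀ {𝓕} → Unique 𝓕 → ∀ C → C L.∈ window 𝓕 → ∣ C ∣ ! ≤ 4 * Q * hitCount (window 𝓕) C →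
              C L.∈ 𝓕 × ManyEdges 𝓕 C
    core-at {𝓕} uniq C C∈W frequent =
      W⊆𝓕 C∈W , E , (isHL , greedy-distinct candidates) , greedy-degree candidates , bound
      where
      W⊆𝓕 : ∀ {A} → A L.∈ window 𝓕 → A L.∈ 𝓕
      W⊆𝓕 A∈W = proj₁ (∈-filter⁻ inWindow? {xs = 𝓕} A∈W)
      inWindow : ∀ {A} → A L.∈ window 𝓕 → Inside A
      inWindow A∈W = proj₂ (∈-filter⁻ inWindow? {xs = 𝓕} A∈W)
      inC : Inside C
      inC = inWindow C∈W
      widthC : ∀ {A} → A L.∈ window 𝓕 → ∣ C ∣ ∸ ∣ A ∣ ≤ 4 * a
      widthC {A} A∈W = width A C (inWindow A∈W) inC
      open Blocks (Unique.filter⁺ inWindow? uniq) C (4 * a) widthC (2≤size C inC) (2K<size C inC)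
      open Greedy {n} n using (greedy-distinct; greedy-degree)
      isHL : All (IsHLEdge 𝓕 C) E
      isHL = All.map (λ (A∈W , B∈W , rest) → W⊆𝓕 A∈W , W⊆𝓕 B∈W , rest) E-isHLEdge
      double : ∀ Q h → 2 * (4 * Q * h) ≡ 8 * Q * h
      double = solve-∀
      veryFrequent : 2 * ∣ C ∣ ! ≤ 8 * Q * hitCount (window 𝓕) C
      veryFrequent = ≤-trans (*-monoʳ-≤ 2 frequent) (≤-reflexive (double Q (hitCount (window 𝓕) C)))
      bound : n * n ≤ 18 * (6 * (8 * Q * (8 * Q)) * length E)
      bound = ≤-trans (n²≤18size C inC) (*-monoʳ-≤ 18 (many-edges (8 * Q) (32Qa≤size C inC) veryFrequent))

    core : (𝓕 : List (Subset n)) → Unique 𝓕 → suc Q * n choose (n / 2) ≤ Q * length 𝓕 →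
           ∃ λ C → C L.∈ 𝓕 × ManyEdges 𝓕 C
    core 𝓕 uniq large =
      let (C , C∈W , frequent) = frequentlyHit {Q = Q} (s≤s z≤n) (Unique.filter⁺ inWindow? uniq) (window-large {𝓕} uniq large)
      in C , core-at uniq C C∈W frequent

-- Passage to rational ε

open import Data.Integer using (+_; -[1+_]; +0; +[1+_])
import Data.Integer as ℤ
import Data.Integer.Properties as ℤ
open import Data.Rational using (ℚ; mkℚ; toℚᵘ; 0ℚ; 1ℚ)
import Data.Rational as ℚ
import Data.Rational.Properties as ℚ
open import Data.Rational.Unnormalised using (ℚᵘ; mkℚᵘ; 1ℚᵘ)
import Data.Rational.Unnormalised as ℚᵘ
import Data.Rational.Unnormalised.Properties as ℚᵘ

toℚᵘ-+/ : ∀ k d .{{_ : NonZero d}} → toℚᵘ (+ k ℚ./ d) ℚᵘ.≃ (+ k ℚᵘ./ d)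
toℚᵘ-+/ k (suc d) = ℚ.toℚᵘ-fromℚᵘ (mkℚᵘ (+ k) d)

-- Over `ℚᵘ` nothing is reduced to lowest terms, so the comparison unfolds to an integer inequality;
-- the stray factors 1 are the denominators of `1ℚ`, `M` and `L`.
size-hypothesis : ∀ {ε p d M L} → toℚᵘ ε ≡ mkℚᵘ (+ p) d →
                  (1ℚ ℚ.+ ε) ℚ.* (+ M ℚ./ 1) ℚ.≤ (+ L ℚ./ 1) → (suc d + p) * M ≤ suc d * L
size-hypothesis {ε} {p} {d} {M} {L} εᵘ large = begin
  (suc d + p) * M              ≡⟨ lhs (suc d) p M ⟩
  (1 * suc d + p * 1) * M * 1  ≤⟨ ℤ.drop‿+≤+ (subst₂ ℤ._≤_ lhs≡ (sym (ℤ.pos-* L _)) (ℚᵘ.drop-*≤* largeᵘ)) ⟩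
  L * (1 * suc d * 1)          ≡⟨ rhs L (suc d) ⟩
  suc d * L                    ∎
  where
  open ≤-Reasoning
  lhs : ∀ d p M → (d + p) * M ≡ (1 * d + p * 1) * M * 1
  lhs = solve-∀
  rhs : ∀ L d → L * (1 * d * 1) ≡ d * L
  rhs = solve-∀
  e : ℚᵘ
  e = mkℚᵘ (+ p) d
  ≃-lhs : toℚᵘ ((1ℚ ℚ.+ ε) ℚ.* (+ M ℚ./ 1)) ℚᵘ.≃ (1ℚᵘ ℚᵘ.+ e) ℚᵘ.* mkℚᵘ (+ M) 0
  ≃-lhs = ℚᵘ.≃-trans (ℚ.toℚᵘ-homo-* (1ℚ ℚ.+ ε) (+ M ℚ./ 1))
    (ℚᵘ.*-cong (ℚᵘ.≃-trans (ℚ.toℚᵘ-homo-+ 1ℚ ε) (ℚᵘ.≃-reflexive (cong (1ℚᵘ ℚᵘ.+_) εᵘ))) (toℚᵘ-+/ M 1))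
  largeᵘ : (1ℚᵘ ℚᵘ.+ e) ℚᵘ.* mkℚᵘ (+ M) 0 ℚᵘ.≤ mkℚᵘ (+ L) 0
  largeᵘ = ℚᵘ.≤-respʳ-≃ (toℚᵘ-+/ L 1) (ℚᵘ.≤-respˡ-≃ ≃-lhs (ℚ.toℚᵘ-mono-≤ large))
  lhs≡ : (+ 1 ℤ.* + suc d ℤ.+ + p ℤ.* + 1) ℤ.* + M ℤ.* + 1 ≡ + ((1 * suc d + p * 1) * M * 1)
  lhs≡ = trans (cong (λ z → z ℤ.* + M ℤ.* + 1) (cong₂ ℤ._+_ (sym (ℤ.pos-* 1 (suc d))) (sym (ℤ.pos-* p 1))))
    (trans (cong (ℤ._* + 1) (sym (ℤ.pos-* (1 * suc d + p * 1) M))) (sym (ℤ.pos-* ((1 * suc d + p * 1) * M) 1)))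

edge-conclusion : ∀ {ε p d k N} .{{_ : NonZero N}} {e} → toℚᵘ ε ≡ mkℚᵘ (+ p) d →
                  p * p * k ≤ e * (suc d * suc d * N) → (ε ℚ.* ε) ℚ.* (+ k ℚ./ N) ℚ.≤ (+ e ℚ./ 1)
edge-conclusion {ε} {p} {d} {k} {N@(suc N-1)} {e} εᵘ many =
  ℚ.toℚᵘ-cancel-≤ (ℚᵘ.≤-respʳ-≃ (ℚᵘ.≃-sym (toℚᵘ-+/ e 1)) (ℚᵘ.≤-respˡ-≃ (ℚᵘ.≃-sym ≃-lhs)
    (ℚᵘ.*≤* (subst₂ ℤ._≤_ (sym lhs≡) (ℤ.pos-* e _) (ℤ.+≤+ (≤-trans (≤-reflexive (*-identityʳ _)) many))))))
  where
  x : ℚᵘ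
  x = mkℚᵘ (+ p) d
  ≃-lhs : toℚᵘ ((ε ℚ.* ε) ℚ.* (+ k ℚ./ N)) ℚᵘ.≃ (x ℚᵘ.* x) ℚᵘ.* mkℚᵘ (+ k) N-1
  ≃-lhs = ℚᵘ.≃-trans (ℚ.toℚᵘ-homo-* (ε ℚ.* ε) (+ k ℚ./ N))
    (ℚᵘ.*-cong (ℚᵘ.≃-trans (ℚ.toℚᵘ-homo-* ε ε) (ℚᵘ.≃-reflexive (cong₂ ℚᵘ._*_ εᵘ εᵘ))) (toℚᵘ-+/ k N))
  lhs≡ : + p ℤ.* + p ℤ.* + k ℤ.* + 1 ≡ + (p * p * k * 1)
  lhs≡ = trans (cong (λ z → z ℤ.* + k ℤ.* + 1) (sym (ℤ.pos-* p p)))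
    (trans (cong (ℤ._* + 1) (sym (ℤ.pos-* (p * p) k))) (sym (ℤ.pos-* (p * p * k) 1)))

-- Passes from ε = p/D to the smaller 1/Q. With Qp = D + r, the hypothesis also yields M ≤ L, and r
-- copies of this make up the difference.
scale-hypothesis : ∀ {p D Q M L} .{{_ : NonZero p}} .{{_ : NonZero D}} → D ≤ Q * p →
                   (D + p) * M ≤ D * L → suc Q * M ≤ Q * L
scale-hypothesis {p} {D} {Q} {M} {L} D≤Qp large = *-cancelˡ-≤ p (begin
  p * (suc Q * M)              ≡⟨ expand₁ p Q M ⟩
  p * M + Q * p * M            ≡⟨ cong (λ z → p * M + z * M) (m+[n∸m]≡n D≤Qp) ⟨
  p * M + (D + r) * M          ≡⟨ expand₂ p M D r ⟩
  (D + p) * M + r * M          ≤⟨ +-mono-≤ large (*-monoʳ-≤ r M≤L) ⟩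
  D * L + r * L                ≡⟨ *-distribʳ-+ L D r ⟨
  (D + r) * L                  ≡⟨ cong (_* L) (m+[n∸m]≡n D≤Qp) ⟩
  Q * p * L                    ≡⟨ expand₃ Q p L ⟩
  p * (Q * L)                  ∎)
  where
  open ≤-Reasoning
  r : ℕ
  r = Q * p ∸ D
  M≤L : M ≤ L
  M≤L = *-cancelˡ-≤ D (≤-trans (*-monoˡ-≤ M (m≤m+n D p)) large)
  expand₁ : ∀ p Q M → p * (suc Q * M) ≡ p * M + Q * p * M
  expand₁ = solve-∀
  expand₂ : ∀ p M D r → p * M + (D + r) * M ≡ (D + p) * M + r * M
  expand₂ = solve-∀
  expand₃ : ∀ Q p L → Q * p * L ≡ p * (Q * L)
  expand₃ = solve-∀

-- Rounding 1/ε up to Q loses a factor of at most 2; since Q enters squared, this is the 4 in the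
-- condition on `N`.
scale-conclusion : ∀ {p D Q x y z n e N} → Q * p ≤ 2 * D → 4 * (x * y * (z * z)) ≤ N →
                   n * n ≤ x * (y * (z * Q * (z * Q)) * e) → p * p * n ^ 2 ≤ e * (D * D * N)
scale-conclusion {p} {D} {Q} {x} {y} {z} {n} {e} {N} Qp≤2D 4k≤N many = begin
  p * p * n ^ 2                                ≡⟨ cong (λ w → p * p * (n * w)) (*-identityʳ n) ⟩
  p * p * (n * n)                              ≤⟨ *-monoʳ-≤ (p * p) many ⟩
  p * p * (x * (y * (z * Q * (z * Q)) * e))    ≡⟨ regroup₁ p Q x y z e ⟩
  e * (Q * p * (Q * p) * (x * y * (z * z)))    ≤⟨ *-monoʳ-≤ e (*-monoˡ-≤ _ (*-mono-≤ Qp≤2D Qp≤2D)) ⟩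
  e * (2 * D * (2 * D) * (x * y * (z * z)))    ≡⟨ regroup₂ e D (x * y * (z * z)) ⟩
  e * (D * D * (4 * (x * y * (z * z))))        ≤⟨ *-monoʳ-≤ e (*-monoʳ-≤ (D * D) 4k≤N) ⟩
  e * (D * D * N)                              ∎
  where
  open ≤-Reasoning
  regroup₁ : ∀ p Q x y z e → p * p * (x * (y * (z * Q * (z * Q)) * e)) ≡ e * (Q * p * (Q * p) * (x * y * (z * z)))
  regroup₁ = solve-∀
  regroup₂ : ∀ e D k → e * (2 * D * (2 * D) * k) ≡ e * (D * D * (4 * k))
  regroup₂ = solve-∀

-- For ε = p/D take Q = ⌊D/p⌋ + 1, so that 1/Q ≤ ε ≤ 2/Q.
eligible-vertex : ∀ N .{{_ : NonZero N}} → 27648 ≤ N → (ε : ℚ) → 0ℚ ℚ.< ε → ε ℚ.< (+ 1 ℚ./ 200) →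
  Σ ℕ λ n₀ → ∀ n → n₀ ≤ n → (𝓕 : List (Subset n)) → Unique 𝓕 →
  (1ℚ ℚ.+ ε) ℚ.* (+ (n choose (n / 2)) ℚ./ 1) ℚ.≤ (+ length 𝓕 ℚ./ 1) →
  Σ (Subset n) λ C → Eligible 𝓕 n ((ε ℚ.* ε) ℚ.* (+ (n ^ 2) ℚ./ N)) C
eligible-vertex N 27648≤N (mkℚ -[1+ _ ] _ _) (ℚ.*<* ()) _
eligible-vertex N 27648≤N (mkℚ +0 _ _) (ℚ.*<* (ℤ.+<+ ())) _
eligible-vertex N 27648≤N ε@(mkℚ (+[1+ p-1 ]) d _) _ ε<1/200 = Core.n₀ q (127 + 128 * q) (c≡ q) , λ n n₀≤n 𝓕 uniq large →
  let (C , C∈𝓕 , E , isHL , degree≤ , many) = Core.core q (127 + 128 * q) (c≡ q) n₀≤n 𝓕 uniq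
        (scale-hypothesis {p} {D} {Q} D≤Qp (size-hypothesis {ε} {p} {d} {n choose (n / 2)} {length 𝓕} refl large))
  in C , C∈𝓕 , E , isHL , degree≤ , edge-conclusion {ε} {p} {d} {n ^ 2} {N} {length E} refl
       -- The constants of the edge bound are 18 from n², 6 from `many-edges` and 8Q blocks, and
       -- 27648 = 4·18·6·8².
       (scale-conclusion {p} {D} {Q} {18} {6} {8} {n} {length E} {N} Qp≤2D 27648≤N many)
  where
  open ≤-Reasoning
  p D q Q : ℕ
  p = suc p-1
  D = suc d
  q = D / p
  Q = suc q
  c≡ : ∀ q → suc (127 + 128 * q) ≡ 128 * suc q
  c≡ = solve-∀
  D≤Qp : D ≤ Q * p
  D≤Qp = begin
    D                 ≡⟨ m≡m%n+[m/n]*n D p ⟩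
    D % p + q * p     ≤⟨ +-monoˡ-≤ (q * p) (<⇒≤ (m%n<n D p)) ⟩
    p + q * p         ∎
  -- The upper bound on ε enters here: ε ≤ 1 ensures that the 1 added in rounding up at most doubles
  -- 1/ε.
  p≤D : p ≤ D
  p≤D = <⇒≤ (begin-strict
    p          ≤⟨ m≤m*n p 200 ⟩
    p * 200    <⟨ ℤ.drop‿+<+ (subst₂ ℤ._<_ (sym (ℤ.pos-* p 200)) (ℤ.*-identityˡ (+ D)) (ℚ.drop-*<* ε<1/200)) ⟩
    D          ∎)
  Qp≤2D : Q * p ≤ 2 * D
  Qp≤2D = begin
    p + q * p         ≤⟨ +-mono-≤ p≤D (m/n*n≤m D p) ⟩
    D + D             ≡⟨ cong (λ z → D + z) (+-identityʳ D) ⟨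
    2 * D             ∎

open import Data.Nat.Combinatorics using (_C_)

theorem5 : (ε : ℚ) → 0ℚ ℚ.< ε → ε ℚ.< (+ 1 ℚ./ 200) →
    Σ ℕ (λ n₀ → (n : ℕ) → n₀ ℕ.≤ n →
    (𝓕 : List (Subset n)) → Unique 𝓕 →
    (1ℚ ℚ.+ ε) ℚ.* (+ (n C (n / 2)) ℚ./ 1) ℚ.≤ (+ length 𝓕 ℚ./ 1) →
    Σ (Subset n) (λ C → Eligible 𝓕 n ((ε ℚ.* ε) ℚ.* (+ (n ^ 2) ℚ./ (10 ^ 40))) C))
theorem5 = eligible-vertex (10 ^ 40) (≤ᵇ⇒≤ 27648 (10 ^ 40) tt)
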